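{- The logic $\mathsf{C2.F}$ is weakly complete with respect to finite flat order frames: for every $p\in\mathcal{L}_>$, if $p$ is true at every world of every order model based on a finite flat order frame, then $\vdash_{\mathsf{C2.F}}p$.
   Context: Language. Let $At=\{p_0,p_1,\ldots\}$ be a countably infinite set of atoms. $\mathcal{L}_>$ is generated by $p ::= p_k\in At\mid \neg p\mid (p\wedge p)\mid (p>p)$; $\vee,\to,\leftrightarrow$ are defined as usual. Logics. $\mathsf{C2}$ is the smallest set of $\mathcal{L}_>$-sentences containing all instances of: (PC) every (substitution instance of a) theorem of classical propositional logic; (Identity) $p>p$; (Reciprocity) $(p>q)\wedge(q>p)\wedge(p>r)\to(q>r)$; (MP) $(p>q)\to(p\to q)$; (CEM) $(p>q)\vee(p>\neg q)$; and closed under (Detachment) from $\vdash p\to q$ and $\vdash p$ infer $\vdash q$; (Normality) from $\vdash(p\wedge q)\to r$ infer $\vdash((s>p)\wedge(s>q))\to(s>r)$. $\mathsf{C2.F}$ is the smallest extension of $\mathsf{C2}$ containing every instance of (Flattening) $(p>((p\wedge q)>r))\leftrightarrow((p\wedge q)>r)$ and closed under Detachment and Normality. $\vdash_{\mathsf{C2.F}}p$ means $p\in\mathsf{C2.F}$. Order frames and models. An order frame is a pair $\langle W,<\rangle$ where $W\neq\varnothing$ and $<$ is a function taking each $w\in W$ to a strict well-order $<_w$ on some subset of $W$ such that whenever $x<_w y$, either $w=x$ or $w<_w x$. Its accessibility relation is $R(w)=\{w\}\cup\{v: w<_w v\}$. An order model $\langle W,<,V\rangle$ adds a valuation $V:At\times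 W\to\{0,1\}$; put $V(p_k)=\{w:V(p_k,w)=1\}$. Denotations: $[\![p_k]\!]=V(p_k)$, $[\![\neg p]\!]=W\setminus[\![p]\!]$, $[\![p\wedge q]\!]=[\![p]\!]\cap[\![q]\!]$, and $w\in[\![p>q]\!]$ iff either $R(w)\cap[\![p]\!]=\varnothing$, or there is $y\in R(w)\cap[\![p]\!]\cap[\![q]\!]$ such that $x\notin[\![p]\!]$ whenever $x<_w y$. A sentence $p$ is true at $w$ iff $w\in[\![p]\!]$. A frame is finite iff $W$ is finite. An order frame is semi-flat iff whenever $x<_w y$, we have $y\in R(x)$ and, for all $z$ such that $y<_w z$ or $z\in R(x)\setminus R(w)$, $y<_x z$. It is flat iff it is semi-flat and $R$ is transitive. -}

module Defs where

open import Data.Bool.Base as Bool using (Bool; true)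
open import Data.Fin.Base using (Fin)
open import Data.Nat.Base using (ℕ)
open import Data.Product.Base using (Σ; _×_; proj₁; ∃-syntax)
open import Data.Sum.Base using (_⊎_)
open import Function.Base using (_on_)
open import Function.Bundles using (_↔_)
open import Induction.WellFounded using (WellFounded)
open import Level using (0ℓ)
open import Relation.Binary.Core using (Rel)
open import Relation.Binary.Definitions using (Transitive)
open import Relation.Binary.PropositionalEquality.Core using (_≡_)
open import Relation.Binary.Structures using (IsStrictTotalOrder)
open import Relation.Unary using (Pred; Decidable; Empty; ∁; _∩_; _∪_; _∖_; _∈_; _∉_; ｛_｝)

infix  10 ∼_ ∼ᵖ_
infixr 9 _∧_ _∧ᵖ_
infixr 8 _∨_
infix  7 _>_
infixr 6 _⇒_
infix  5 _⇔_

data Form : Set where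
  atom : ℕ → Form
  ∼_   : Form → Form
  _∧_  : Form → Form → Form
  _>_  : Form → Form → Form

_∨_ _⇒_ _⇔_ : Form → Form → Form
p ∨ q = ∼ (∼ p ∧ ∼ q)
p ⇒ q = ∼ (p ∧ ∼ q)
p ⇔ q = (p ⇒ q) ∧ (q ⇒ p)

-- Formulas of classical propositional logic. Its theorems are the truth-table
-- tautologies; their instances in Form arise by uniform substitution.

data PForm : Set where
  var  : ℕ → PForm
  ∼ᵖ_  : PForm → PForm
  _∧ᵖ_ : PForm → PForm → PForm

eval : (ℕ → Bool) → PForm → Bool
eval v (var k)  = v k
eval v (∼ᵖ φ)   = Bool.not (eval v φ)
eval v (φ ∧ᵖ ψ) = eval v φ Bool.∧ eval v ψ

Tautology : Pred PForm 0ℓ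
Tautology φ = ∀ v → eval v φ ≡ true

_[_] : PForm → (ℕ → Form) → Form
var k    [ σ ] = σ k
(∼ᵖ φ)   [ σ ] = ∼ (φ [ σ ])
(φ ∧ᵖ ψ) [ σ ] = (φ [ σ ]) ∧ (ψ [ σ ])

data C2 : Pred Form 0ℓ where
  pc          : ∀ φ → Tautology φ → ∀ σ → C2 (φ [ σ ])
  identity    : ∀ p → C2 (p > p)
  reciprocity : ∀ p q r → C2 ((((p > q) ∧ (q > p)) ∧ (p > r)) ⇒ (q > r))
  mp          : ∀ p q → C2 ((p > q) ⇒ (p ⇒ q))
  cem         : ∀ p q → C2 ((p > q) ∨ (p > (∼ q)))
  detachment  : ∀ {p q} → C2 (p ⇒ q) → C2 p → C2 q
  normality   : ∀ {p q r} s → C2 ((p ∧ q) ⇒ r) → C2 (((s > p) ∧ (s > q)) ⇒ (s > r))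

data C2F : Pred Form 0ℓ where
  c2         : ∀ {p} → C2 p → C2F p
  flattening : ∀ p q r → C2F ((p > ((p ∧ q) > r)) ⇔ ((p ∧ q) > r))
  detachment : ∀ {p q} → C2F (p ⇒ q) → C2F p → C2F q
  normality  : ∀ {p q r} s → C2F ((p ∧ q) ⇒ r) → C2F (((s > p) ∧ (s > q)) ⇒ (s > r))

infix 4 ⊢C2F_

⊢C2F_ : Form → Set
⊢C2F p = p ∈ C2F

-- x <[ w ] y is the order x <_w y, a strict well-order on the subset dom w of W.
-- The field <-dom says that it relates no worlds outside that subset.

record OrderFrame : Set₁ where
  field
    W        : Set
    nonempty : W
    dom      : W → Pred W 0ℓ
    _<[_]_   : W → W → W → Set

  <-on-dom : (w : W) → Rel (Σ W (dom w)) 0ℓ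
  <-on-dom w = (λ x y → x <[ w ] y) on proj₁

  field
    <-dom                : ∀ {w x y} → x <[ w ] y → x ∈ dom w × y ∈ dom w
    <-isStrictTotalOrder : ∀ w → IsStrictTotalOrder (_≡_ on proj₁) (<-on-dom w)
    <-wellFounded        : ∀ w → WellFounded (<-on-dom w)
    <-centred            : ∀ {w x y} → x <[ w ] y → w ≡ x ⊎ w <[ w ] x

  R : W → Pred W 0ℓ
  R w = ｛ w ｝ ∪ (λ v → w <[ w ] v)

-- Classically, every subset of a finite set is decidable; here this is recorded
-- for the sets dom w. Together with trichotomy on dom w it makes each order, and
-- hence truth in a finite model, decidable.

record Finite (F : OrderFrame) : Set where
  open OrderFrame F
  field
    size  : ℕ
    enum  : W ↔ Fin size
    dom?  : ∀ w → Decidable (dom w)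

module _ (F : OrderFrame) where
  open OrderFrame F

  SemiFlat : Set
  SemiFlat = ∀ {w x y} → x <[ w ] y →
    y ∈ R x × (∀ {z} → y <[ w ] z ⊎ z ∈ (R x ∖ R w) → y <[ x ] z)

  Flat : Set
  Flat = SemiFlat × Transitive R

record OrderModel : Set₁ where
  field
    frame : OrderFrame

  open OrderFrame frame public

  field
    V : ℕ → W → Bool

  ⟦_⟧ : Form → Pred W 0ℓ
  ⟦ atom k ⟧ w = V k w ≡ true
  ⟦ ∼ p ⟧      = ∁ ⟦ p ⟧
  ⟦ p ∧ q ⟧    = ⟦ p ⟧ ∩ ⟦ q ⟧
  ⟦ p > q ⟧ w  =
    Empty (R w ∩ ⟦ p ⟧) ⊎
    (∃[ y ] y ∈ (R w ∩ ⟦ p ⟧ ∩ ⟦ q ⟧) × (∀ {x} → x <[ w ] y → x ∉ ⟦ p ⟧))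

{-# OPTIONS --safe #-}

-- Let Φ be the set of subformulas of p, and let types be the truth assignments to Φ.
-- In the canonical picture a world w determines, for every set C of types, the closest
-- world outside C, and thus lists the accessible types in order of closeness.
-- Flattening makes the list seen from a selected world v extend the tail of w's list
-- from v on; earlier types may reappear anywhere in it. Reading on and on from a world
-- one thus meets a transfinite sequence of worlds whose first visits of types give its
-- list. By induction on an initial set C of types of w, the part of this sequence that
-- leads out of C is built as a word with ω-powers: jump to the last type of C through
-- a word for the remaining types, then read on from there. If C still is initial at
-- the world reached, repeat; there are finitely many lists, so eventually one recurs,
-- and the stretch in between can be repeated ω times. The finitely many occurrences of
-- letters in such a word, ordered from each of them by first visit, form a finite flat
-- order frame. Only finitely many theorems are used about w, so instead of maximal
-- consistent sets it suffices to consider Boolean valuations making these true.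

module Submission where

open import Data.Bool.Base as Bool using (Bool; true; false; not; if_then_else_)
open import Data.Bool.Properties using (¬-not; not-¬) renaming (_≟_ to _≟ᵇ_)
open import Data.Empty using (⊥-elim)
open import Data.Fin.Base using (Fin; zero; suc; combine; funToFin; finToFun)
open import Data.Fin.Properties using (+↔⊎; combine-injective; suc-injective; finToFun-funToFin; funToFin-finToFin)
open import Data.Fin.Subset using (Subset; _⊆_; _⊂_; _∪_; ⁅_⁆; ∣_∣; ⊥; ⊤; Nonempty)
  renaming (_∈_ to _∈ˢ_; _∉_ to _∉ˢ_)
open import Data.Fin.Subset.Properties using (_∈?_; _⊆?_; _⊂?_; nonempty?; x∈⁅x⁆; x∈⁅y⁆⇒x≡y; x∈p∪q⁻; p⊆p∪q; q⊆p∪q;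
  p⊂q⇒∣p∣<∣q∣; p⊆q⇒∣p∣≤∣q∣; ∣p∣≤n; ∉⊥; ∈⊤; ⊆-antisym; ⊆-min)
open import Data.List.Base using (List; []; _∷_; [_]; _++_; length; lookup)
open import Data.List.Membership.Propositional using () renaming (_∈_ to _∈ₗ_)
open import Data.List.Membership.Propositional.Properties using (∈-++⁺ˡ; ∈-++⁺ʳ)
open import Data.List.Relation.Unary.All using (All; []; _∷_)
open import Data.List.Relation.Unary.All.Properties using (++⁺; ++⁻ˡ; ++⁻ʳ)
open import Data.List.Relation.Unary.Any as Any using (here; there)
open import Data.List.Relation.Unary.Any.Properties using (lookup-index)
open import Data.Maybe.Base using (Maybe; just; nothing; maybe)
open import Data.Maybe.Properties using (just-injective)
open import Data.Nat.Base using (ℕ; zero; suc; _+_; _*_; _^_; _<_; _≤_; z≤n; s≤s; s≤s⁻¹)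
open import Data.Nat.Induction using (<-wellFounded)
open import Data.Nat.Properties using (<-irrefl; <-trans; <-cmp; <-≤-trans; <⇒≤; <⇒≱; ≤-trans; n≤1+n; m≤m+n; m≤n+m;
  +-suc; +-monoʳ-<; +-monoʳ-≤; +-cancelˡ-≡; +-cancelˡ-<) renaming (_≟_ to _≟ℕ_)
open import Data.Product.Base using (_×_; _,_; proj₁; proj₂; Σ-syntax; ∃-syntax; uncurry)
open import Data.Sum.Base using (_⊎_; inj₁; inj₂)
open import Data.Sum.Function.Propositional using (_⊎-↔_)
open import Data.Unit.Base using (tt) renaming (⊤ to Unit)
open import Data.Vec.Base using ([]; _∷_; tabulate)
open import Data.Vec.Properties using (lookup∘tabulate; []=⇒lookup; lookup⇒[]=)
open import Function.Base using (_∘_; _on_)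
open import Function.Bundles using (_↔_; mk↔ₛ′)
open import Function.Construct.Composition using (_↔-∘_)
open import Function.Construct.Symmetry using (↔-sym)
open import Induction.WellFounded using (module Subrelation)
import Relation.Binary.Construct.On as On
open import Relation.Binary.Definitions using (DecidableEquality; tri<; tri≈; tri>)
open import Relation.Binary.PropositionalEquality using (_≡_; refl; sym; trans; cong; cong₂; subst)
open import Relation.Nullary using (Dec; yes; no; ¬_)
open import Relation.Nullary.Decidable using (map′; _×-dec_)
open import Relation.Unary using (_∈_)
open import Defs renaming (_[_] to _⟨_⟩)


-- Propositional reasoning: valuations and tautologies

_≟_ : DecidableEquality Form
atom k  ≟ atom l  = map′ (cong atom) (λ { refl → refl }) (k ≟ℕ l)
(∼ p)   ≟ (∼ q)   = map′ (cong ∼_) (λ { refl → refl }) (p ≟ q)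
(p ∧ q) ≟ (r ∧ s) = map′ (uncurry (cong₂ _∧_)) (λ { refl → refl , refl }) ((p ≟ r) ×-dec (q ≟ s))
(p > q) ≟ (r > s) = map′ (uncurry (cong₂ _>_)) (λ { refl → refl , refl }) ((p ≟ r) ×-dec (q ≟ s))
atom _  ≟ (∼ _)   = no λ ()
atom _  ≟ (_ ∧ _) = no λ ()
atom _  ≟ (_ > _) = no λ ()
(∼ _)   ≟ atom _  = no λ ()
(∼ _)   ≟ (_ ∧ _) = no λ ()
(∼ _)   ≟ (_ > _) = no λ ()
(_ ∧ _) ≟ atom _  = no λ ()
(_ ∧ _) ≟ (∼ _)   = no λ ()
(_ ∧ _) ≟ (_ > _) = no λ ()
(_ > _) ≟ atom _  = no λ ()
(_ > _) ≟ (∼ _)   = no λ ()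
(_ > _) ≟ (_ ∧ _) = no λ ()

-- A valuation is free on atoms and conditionals; its values at negations and
-- conjunctions are ignored by ev.

Val : Set
Val = Form → Bool

ev : Val → Form → Bool
ev v (atom k) = v (atom k)
ev v (∼ p)    = not (ev v p)
ev v (p ∧ q)  = ev v p Bool.∧ ev v q
ev v (p > q)  = v (p > q)

infix 4 _⊨_

_⊨_ : Val → Form → Set
v ⊨ p = ev v p ≡ true

quasiAtoms : Form → List Form
quasiAtoms (atom k) = [ atom k ]
quasiAtoms (∼ p)    = quasiAtoms p
quasiAtoms (p ∧ q)  = quasiAtoms p ++ quasiAtoms q
quasiAtoms (p > q)  = [ p > q ]

index : List Form → Form → ℕ
index []      q = zero
index (r ∷ L) q with r ≟ q
... | yes _ = zero
... | no  _ = suc (index L q)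

nth : List Form → ℕ → Form
nth []      _       = atom zero
nth (r ∷ L) zero    = r
nth (r ∷ L) (suc k) = nth L k

nth-index : ∀ {L q} → q ∈ₗ L → nth L (index L q) ≡ q
nth-index {r ∷ L} {q} q∈ with r ≟ q
... | yes r≡q = r≡q
... | no  r≢q with q∈
...   | here q≡r = ⊥-elim (r≢q (sym q≡r))
...   | there q∈L = nth-index q∈L

skeleton : List Form → Form → PForm
skeleton L (atom k) = var (index L (atom k))
skeleton L (∼ p)    = ∼ᵖ skeleton L p
skeleton L (p ∧ q)  = skeleton L p ∧ᵖ skeleton L q
skeleton L (p > q)  = var (index L (p > q))

skeleton-nth : ∀ L p → (∀ {q} → q ∈ₗ quasiAtoms p → q ∈ₗ L) → skeleton L p ⟨ nth L ⟩ ≡ p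
skeleton-nth L (atom k) p⊆L = nth-index (p⊆L (here refl))
skeleton-nth L (∼ p)    p⊆L = cong ∼_ (skeleton-nth L p p⊆L)
skeleton-nth L (p ∧ q)  p⊆L = cong₂ _∧_
  (skeleton-nth L p (λ r∈ → p⊆L (∈-++⁺ˡ r∈)))
  (skeleton-nth L q (λ r∈ → p⊆L (∈-++⁺ʳ (quasiAtoms p) r∈)))
skeleton-nth L (p > q)  p⊆L = nth-index (p⊆L (here refl))

eval-skeleton : ∀ L u p → eval u (skeleton L p) ≡ ev (λ q → u (index L q)) p
eval-skeleton L u (atom k) = refl
eval-skeleton L u (∼ p)    = cong not (eval-skeleton L u p)
eval-skeleton L u (p ∧ q)  = cong₂ Bool._∧_ (eval-skeleton L u p) (eval-skeleton L u q)
eval-skeleton L u (p > q)  = refl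

-- Numbering the atoms and conditionals of `p` gives a propositional skeleton. Each assignment to
-- the numbers induces a valuation with the same value, so the skeleton is a truth-table tautology;
-- `nth` substitutes the formulas back.
tautology : ∀ {p} → (∀ v → v ⊨ p) → ⊢C2F p
tautology {p} valid = c2 (subst C2 (skeleton-nth L p (λ q∈ → q∈))
  (pc (skeleton L p) (λ u → trans (eval-skeleton L u p) (valid _)) (nth L)))
  where L = quasiAtoms p

⊨-⇒⁺ : ∀ v p q → (v ⊨ p → v ⊨ q) → v ⊨ p ⇒ q
⊨-⇒⁺ v p q f with ev v p
... | false = refl
... | true  = cong (λ b → not (not b)) (f refl)

⊨-⇒⁻ : ∀ v p q → v ⊨ p ⇒ q → v ⊨ p → v ⊨ q
⊨-⇒⁻ v p q p⇒q v⊨p with ev v p | ev v q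
⊨-⇒⁻ v p q p⇒q v⊨p | true | true = refl

⊨-∧⁻ : ∀ v p q → v ⊨ p ∧ q → v ⊨ p × v ⊨ q
⊨-∧⁻ v p q e with ev v p | ev v q
... | true | true = refl , refl

⊨-∧⁺ : ∀ v p q → v ⊨ p → v ⊨ q → v ⊨ p ∧ q
⊨-∧⁺ v p q = cong₂ Bool._∧_

≡-from-⇔ : ∀ {a b} → (a ≡ true → b ≡ true) → (b ≡ true → a ≡ true) → a ≡ b
≡-from-⇔ {false} {false} f g = refl
≡-from-⇔ {false} {true}  f g = g refl
≡-from-⇔ {true}          f g = sym (f refl)

-- Consequences of finitely many theorems

Sat : Val → List Form → Set
Sat v = All (v ⊨_)

-- Enforced properties hold of every valuation making finitely many theorems true.
-- This is a finitary substitute for maximal consistent sets, which are not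
-- available constructively.

Enforced : (Val → Set) → Set
Enforced P = Σ[ Γ ∈ List Form ] All C2F Γ × (∀ v → Sat v Γ → P v)

-- Premises are moved into implications one at a time until a tautology remains, and are then
-- detached again.
entailed-⊢ : ∀ Γ {p} → All C2F Γ → (∀ v → Sat v Γ → v ⊨ p) → ⊢C2F p
entailed-⊢ []          []        f = tautology λ v → f v []
entailed-⊢ (γ ∷ Γ) {p} (⊢γ ∷ ⊢Γ) f = C2F.detachment
  (entailed-⊢ Γ ⊢Γ λ v sat → ⊨-⇒⁺ v γ p λ v⊨γ → f v (v⊨γ ∷ sat)) ⊢γ

enforced-⊢ : ∀ {p} → Enforced (_⊨ p) → ⊢C2F p
enforced-⊢ (Γ , ⊢Γ , f) = entailed-⊢ Γ ⊢Γ f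

⊢-enforced : ∀ {p} → ⊢C2F p → Enforced (_⊨ p)
⊢-enforced {p} ⊢p = [ p ] , ⊢p ∷ [] , λ { v (v⊨p ∷ []) → v⊨p }

always : ∀ {P} → (∀ v → P v) → Enforced P
always f = [] , [] , λ v _ → f v

enf-map : ∀ {P Q} → (∀ v → P v → Q v) → Enforced P → Enforced Q
enf-map f (Γ , ⊢Γ , h) = Γ , ⊢Γ , λ v sat → f v (h v sat)

enf-× : ∀ {P Q} → Enforced P → Enforced Q → Enforced (λ v → P v × Q v)
enf-× (Γ , ⊢Γ , f) (Δ , ⊢Δ , g) =
  Γ ++ Δ , ++⁺ ⊢Γ ⊢Δ , λ v sat → f v (++⁻ˡ Γ sat) , g v (++⁻ʳ Γ sat)

enf-map₂ : ∀ {P Q R} → (∀ v → P v → Q v → R v) → Enforced P → Enforced Q → Enforced R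
enf-map₂ f p q = enf-map (λ v → uncurry (f v)) (enf-× p q)

enf-Fin : ∀ {n} {P : Fin n → Val → Set} → (∀ i → Enforced (P i)) → Enforced (λ v → ∀ i → P i v)
enf-Fin {zero}  f = always λ v ()
enf-Fin {suc n} f = enf-map₂ (λ { v p q zero → p ; v p q (suc i) → q i })
  (f zero) (enf-Fin λ i → f (suc i))

enf-Subset : ∀ {n} {P : Subset n → Val → Set} → (∀ C → Enforced (P C)) → Enforced (λ v → ∀ C → P C v)
enf-Subset {zero}  f = enf-map (λ { v p [] → p }) (f [])
enf-Subset {suc n} f = enf-map₂ (λ { v p q (false ∷ C) → p C ; v p q (true ∷ C) → q C })
  (enf-Subset λ C → f (false ∷ C)) (enf-Subset λ C → f (true ∷ C))

enf-⇒ : ∀ {p q} → ⊢C2F (p ⇒ q) → Enforced (λ v → v ⊨ p → v ⊨ q)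
enf-⇒ {p} {q} ⊢p⇒q = enf-map (λ v → ⊨-⇒⁻ v p q) (⊢-enforced ⊢p⇒q)

⊢-⇒ : ∀ {p q} → (∀ v → v ⊨ p → v ⊨ q) → ⊢C2F (p ⇒ q)
⊢-⇒ {p} {q} f = tautology λ v → ⊨-⇒⁺ v p q (f v)

-- Derived principles for conditionals

enf-monotone : ∀ s {p q} → ⊢C2F (p ⇒ q) → Enforced (λ v → v ⊨ s > p → v ⊨ s > q)
enf-monotone s {p} {q} ⊢p⇒q = enf-map
  (λ v h s>p → h (⊨-∧⁺ v (s > p) (s > p) s>p s>p))
  -- Normality takes two consequents; both are chosen to be `p`.
  (enf-⇒ (C2F.normality s (enforced-⊢ (enf-map
    (λ v h → ⊨-⇒⁺ v (p ∧ p) q λ p∧p → h (proj₁ (⊨-∧⁻ v p p p∧p)))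
    (enf-⇒ ⊢p⇒q)))))

enf-strict : ∀ {s q} → ⊢C2F (s ⇒ q) → Enforced (_⊨ s > q)
enf-strict {s} ⊢s⇒q = enf-map₂ (λ v f s>s → f s>s)
  (enf-monotone s ⊢s⇒q) (⊢-enforced (c2 (identity s)))

necessitation : ∀ s {p} → ⊢C2F p → ⊢C2F (s > p)
necessitation s {p} ⊢p = enforced-⊢ (enf-strict (enforced-⊢
  (enf-map (λ v v⊨p → ⊨-⇒⁺ v s p λ _ → v⊨p) (⊢-enforced ⊢p))))

enf-conjoin : ∀ s {p q r} → (∀ v → v ⊨ p → v ⊨ q → v ⊨ r) →
  Enforced (λ v → v ⊨ s > p → v ⊨ s > q → v ⊨ s > r)
enf-conjoin s {p} {q} {r} f = enf-map
  (λ v h s>p s>q → h (⊨-∧⁺ v (s > p) (s > q) s>p s>q))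
  (enf-⇒ (C2F.normality s (⊢-⇒ {p ∧ q} {r} λ v p∧q → uncurry (f v) (⊨-∧⁻ v p q p∧q))))

enf-reciprocity : ∀ p q r → Enforced (λ v → v ⊨ p > q → v ⊨ q > p → v ⊨ p > r → v ⊨ q > r)
enf-reciprocity p q r = enf-map
  (λ v h p>q q>p p>r → h (⊨-∧⁺ v ((p > q) ∧ (q > p)) (p > r) (⊨-∧⁺ v (p > q) (q > p) p>q q>p) p>r))
  (enf-⇒ (c2 (reciprocity p q r)))

-- Provable equivalence yields `p > q` and `q > p`, the first two premises of Reciprocity in either
-- direction.
enf-substitute : ∀ {p q} r → ⊢C2F (p ⇒ q) → ⊢C2F (q ⇒ p) → Enforced (λ v → v (p > r) ≡ v (q > r))
enf-substitute {p} {q} r ⊢p⇒q ⊢q⇒p = enf-map₂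
  (λ { v (p>q , q>p) (f , g) → ≡-from-⇔ (f p>q q>p) (g q>p p>q) })
  (enf-× (enf-strict ⊢p⇒q) (enf-strict ⊢q⇒p))
  (enf-× (enf-reciprocity p q r) (enf-reciprocity q p r))

falsum verum : Form
falsum = atom zero ∧ ∼ atom zero
verum  = ∼ falsum

ev-falsum : ∀ v → ev v falsum ≡ false
ev-falsum v with v (atom zero)
... | true  = refl
... | false = refl

⊭-falsum : ∀ {A : Set} v → v ⊨ falsum → A
⊭-falsum v v⊨⊥ with () ← trans (sym (ev-falsum v)) v⊨⊥

-- From `s > falsum` follows `s > t`; as `t > s` holds too, Reciprocity carries `falsum` over to
-- `t`.
enf-void : ∀ {s t} → ⊢C2F (t ⇒ s) → Enforced (λ v → v ⊨ s > falsum → v ⊨ t > falsum)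
enf-void {s} {t} ⊢t⇒s = enf-map₂
  (λ { v (f , t>s) g s>⊥ → g (f s>⊥) t>s s>⊥ })
  (enf-× (enf-monotone s (⊢-⇒ (λ v → ⊭-falsum v))) (enf-strict ⊢t⇒s))
  (enf-reciprocity s t falsum)

-- What v says about the closest s-world.

shift : Form → Val → Val
shift s v q = v (s > q)

Possible : Form → Val → Set
Possible s v = v (s > falsum) ≡ false

enf-negation : ∀ s p → Enforced (λ v → Possible s v → not (v (s > p)) ≡ v (s > (∼ p)))
enf-negation s p = enf-map₂ lemma (⊢-enforced (c2 (cem s p))) (enf-conjoin s {p} {∼ p} {falsum} contradictory)
  where
  contradictory : ∀ v → v ⊨ p → v ⊨ ∼ p → v ⊨ falsum
  contradictory v v⊨p v⊨∼p with () ← trans (sym v⊨∼p) (cong not v⊨p)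

  lemma : ∀ v → v ⊨ (s > p) ∨ (s > (∼ p)) → (v ⊨ s > p → v ⊨ s > (∼ p) → v ⊨ s > falsum) →
    Possible s v → not (v (s > p)) ≡ v (s > (∼ p))
  lemma v total clash possible with v (s > p) | v (s > (∼ p)) | v (s > falsum)
  ... | true  | false | _     = refl
  ... | false | true  | _     = refl
  ... | true  | true  | false with () ← clash refl refl

-- On atoms and conditionals this is the definition of `shift`. CEM and Normality make `s >` commute
-- with negation and conjunction when `s` is possible.
enf-shift : ∀ s p → Enforced (λ v → Possible s v → ev (shift s v) p ≡ v (s > p))
enf-shift s (atom k) = always λ v _ → refl
enf-shift s (p > q)  = always λ v _ → refl
enf-shift s (∼ p)    = enf-map₂
  (λ v ih h possible → trans (cong not (ih possible)) (h possible))
  (enf-shift s p) (enf-negation s p)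
enf-shift s (p ∧ q)  = enf-map₂
  (λ { v (ihp , ihq) (f , g , h) possible → trans (cong₂ Bool._∧_ (ihp possible) (ihq possible))
       (≡-from-⇔ (λ e → uncurry f (⊨-∧⁻ v (s > p) (s > q) e)) (λ e → ⊨-∧⁺ v (s > p) (s > q) (g e) (h e))) })
  (enf-× (enf-shift s p) (enf-shift s q))
  (enf-× (enf-conjoin s {p} {q} {p ∧ q} (λ v → ⊨-∧⁺ v p q))
    (enf-× (enf-monotone s (⊢-⇒ λ v e → proj₁ (⊨-∧⁻ v p q e)))
           (enf-monotone s (⊢-⇒ λ v e → proj₂ (⊨-∧⁻ v p q e)))))

-- Necessitation puts each theorem under `s >`, and `enf-shift` turns this into truth at the closest
-- `s`-world.
enf-Possible : ∀ {P} s → Enforced P → Enforced (λ v → Possible s v → P (shift s v))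
enf-Possible {P} s (Γ , ⊢Γ , f) =
  enf-map (λ v sat possible → f (shift s v) (sat possible)) (lift Γ ⊢Γ)
  where
  lift : ∀ Δ → All C2F Δ → Enforced (λ v → Possible s v → Sat (shift s v) Δ)
  lift []      []        = always λ v _ → []
  lift (δ ∷ Δ) (⊢δ ∷ ⊢Δ) = enf-map₂
    (λ { v (e , s>δ) sat possible → trans (e possible) s>δ ∷ sat possible })
    (enf-× (enf-shift s δ) (⊢-enforced (necessitation s ⊢δ))) (lift Δ ⊢Δ)

enf-centering : ∀ s p → Enforced (λ v → v ⊨ s → v (s > p) ≡ ev v p)
enf-centering s p = enf-map₂ lemma
  (enf-× (enf-⇒ (c2 (mp s p))) (enf-⇒ (c2 (mp s (∼ p))))) (⊢-enforced (c2 (cem s p)))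
  where
  lemma : ∀ v → (v ⊨ s > p → v ⊨ s ⇒ p) × (v ⊨ s > (∼ p) → v ⊨ s ⇒ ∼ p) →
    v ⊨ (s > p) ∨ (s > (∼ p)) → v ⊨ s → v (s > p) ≡ ev v p
  lemma v (f , g) total v⊨s with v (s > p) in e | v (s > (∼ p)) in e′
  ... | true  | _     = sym (⊨-⇒⁻ v s p (f refl) v⊨s)
  ... | false | true  with ev v p | ⊨-⇒⁻ v s (∼ p) (g refl) v⊨s
  ...   | false | _ = refl

-- Flattening speaks of `s ∧ t`, which is interchangeable with `t` here; the exchange is made both
-- in the plain conditional and under `s >`.
enf-flattening : ∀ {s t} r → ⊢C2F (t ⇒ s) → Enforced (λ v → v (s > (t > r)) ≡ v (t > r))
enf-flattening {s} {t} r ⊢t⇒s = enf-map₂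
  (λ { v (st≡t , to , from) (f , g) → ≡-from-⇔
     (λ e → trans (sym st≡t) (to (f e)))
     (λ e → g (from (trans st≡t e))) })
  (enf-× st≡t (enf-map
    (λ v e → let (to , from) = ⊨-∧⁻ v (p₁ ⇒ p₂) (p₂ ⇒ p₁) e in ⊨-⇒⁻ v p₁ p₂ to , ⊨-⇒⁻ v p₂ p₁ from)
    (⊢-enforced (flattening s t r))))
  (enf-× (enf-monotone s {t > r} {p₂} (enforced-⊢ (enf-map (λ v e → ⊨-⇒⁺ v (t > r) p₂ (trans e)) st≡t)))
         (enf-monotone s {p₂} {t > r} (enforced-⊢ (enf-map (λ v e → ⊨-⇒⁺ v p₂ (t > r) (trans (sym e))) st≡t))))
  where
  p₁ p₂ : Form
  p₁ = s > ((s ∧ t) > r)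
  p₂ = (s ∧ t) > r

  st≡t : Enforced (λ v → v ((s ∧ t) > r) ≡ v (t > r))
  st≡t = enf-substitute r (⊢-⇒ {s ∧ t} {t} λ v e → proj₂ (⊨-∧⁻ v s t e))
    (enforced-⊢ (enf-map (λ v f → ⊨-⇒⁺ v t (s ∧ t) λ v⊨t → ⊨-∧⁺ v s t (f v⊨t) v⊨t) (enf-⇒ ⊢t⇒s)))

-- Order frames from ordinal words

-- Expressions for words of length below ω^ω; the copies of a letter made by ω-powers
-- count as one position.

infixr 5 _∙_
infix  6 _^ω

data Word (A : Set) : Set where
  letter : A → Word A
  _∙_    : Word A → Word A → Word A
  _^ω    : Word A → Word A

private variable
  A : Set
  a b : Word A

data Pos {A : Set} : Word A → Set where
  here  : ∀ {x} → Pos (letter x)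
  left  : ∀ {a b} → Pos a → Pos (a ∙ b)
  right : ∀ {a b} → Pos b → Pos (a ∙ b)
  loop  : ∀ {a} → Pos a → Pos (a ^ω)

at : Pos {A} a → A
at (here {x}) = x
at (left z)   = at z
at (right z)  = at z
at (loop z)   = at z

start : (a : Word A) → Pos a
start (letter x) = here
start (a ∙ b)    = left (start a)
start (a ^ω)     = loop (start a)

size : Word A → ℕ
size (letter x) = 1
size (a ∙ b)    = size a + size b
size (a ^ω)     = size a

enumerate : (a : Word A) → Pos a ↔ Fin (size a)
enumerate (letter x) = mk↔ₛ′ (λ _ → zero) (λ _ → here) (λ { zero → refl }) (λ { here → refl })
enumerate (a ∙ b)    = ↔-sym +↔⊎ ↔-∘ ((enumerate a ⊎-↔ enumerate b) ↔-∘ split)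
  where
  split : Pos (a ∙ b) ↔ (Pos a ⊎ Pos b)
  split = mk↔ₛ′ (λ { (left z) → inj₁ z ; (right z) → inj₂ z })
    (λ { (inj₁ z) → left z ; (inj₂ z) → right z })
    (λ { (inj₁ z) → refl ; (inj₂ z) → refl })
    (λ { (left z) → refl ; (right z) → refl })
enumerate (a ^ω)     = enumerate a ↔-∘ mk↔ₛ′ (λ { (loop z) → z }) loop (λ _ → refl) (λ { (loop z) → refl })

-- reach z y says that y is visited when the word is read from z onwards, and
-- rank z orders the visited positions by their first visit. The value of rank z
-- at unvisited positions is junk.

reach : Pos a → Pos a → Bool
reach here      here      = true
reach (left z)  (left y)  = reach z y
reach (left z)  (right y) = true
reach (right z) (left y)  = false
reach (right z) (right y) = reach z y
reach (loop z)  (loop y)  = true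

-- A strict upper bound on ranks, serving as the offset for what is read later. In a loop the rest
-- of the current pass is followed by a pass from the start, whence the doubling.
bound : Word A → ℕ
bound (letter x) = 1
bound (a ∙ b)    = bound a + bound b
bound (a ^ω)     = bound a + bound a

rank : Pos a → Pos a → ℕ
rank                here      here      = 0
rank                (left z)  (left y)  = rank z y
rank {a = a ∙ b}    (left z)  (right y) = bound a + rank (start b) y
rank                (right z) (left y)  = 0
rank                (right z) (right y) = rank z y
rank {a = a ^ω}     (loop z)  (loop y)  =
  if reach z y then rank z y else bound a + rank (start a) y

reach-start : (y : Pos a) → reach (start a) y ≡ true
reach-start here      = refl
reach-start (left y)  = reach-start y
reach-start (right y) = refl
reach-start (loop y)  = refl

reach-refl : (z : Pos a) → reach z z ≡ true
reach-refl here      = refl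
reach-refl (left z)  = reach-refl z
reach-refl (right z) = reach-refl z
reach-refl (loop z)  = refl

reach-trans : (x y z : Pos a) → reach x y ≡ true → reach y z ≡ true → reach x z ≡ true
reach-trans here      here      here      p q = refl
reach-trans (left x)  (left y)  (left z)  p q = reach-trans x y z p q
reach-trans (left x)  y         (right z) p q = refl
reach-trans (left x)  (right y) (left z)  p ()
reach-trans (right x) (left y)  z         () q
reach-trans (right x) (right y) (left z)  p ()
reach-trans (right x) (right y) (right z) p q = reach-trans x y z p q
reach-trans (loop x)  (loop y)  (loop z)  p q = refl

rank-self : (z : Pos a) → rank z z ≡ 0
rank-self here      = refl
rank-self (left z)  = rank-self z
rank-self (right z) = rank-self z
rank-self (loop z) rewrite reach-refl z = rank-self z

rank<bound : (z y : Pos a) → reach z y ≡ true → rank z y < bound a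
rank<bound here here r = s≤s z≤n
rank<bound {a = a ∙ b} (left z)  (left y)  r = <-≤-trans (rank<bound z y r) (m≤m+n _ (bound b))
rank<bound {a = a ∙ b} (left z)  (right y) r = +-monoʳ-< (bound a) (rank<bound (start b) y (reach-start y))
rank<bound {a = a ∙ b} (right z) (right y) r = <-≤-trans (rank<bound z y r) (m≤n+m (bound b) (bound a))
rank<bound {a = a ^ω} (loop z) (loop y) r with reach z y in e
... | true  = <-≤-trans (rank<bound z y e) (m≤m+n _ _)
... | false = +-monoʳ-< (bound a) (rank<bound (start a) y (reach-start y))

rank≢bound+ : ∀ {B : Set} (z y : Pos a) {k} → reach z y ≡ true → rank z y ≡ bound a + k → B
rank≢bound+ {a = a} z y {k} r e =
  ⊥-elim (<⇒≱ (rank<bound z y r) (subst (bound a ≤_) (sym e) (m≤m+n _ k)))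

bound+≮rank : ∀ {B : Set} (z y : Pos a) {k} → reach z y ≡ true → bound a + k < rank z y → B
bound+≮rank {a = a} z y {k} r lt = ⊥-elim (<⇒≱ (rank<bound z y r) (≤-trans (m≤m+n _ k) (<⇒≤ lt)))

rank-injective : (z x y : Pos a) → reach z x ≡ true → reach z y ≡ true → rank z x ≡ rank z y → x ≡ y
rank-injective here      here      here      p q e = refl
rank-injective (left z)  (left x)  (left y)  p q e = cong left (rank-injective z x y p q e)
rank-injective (left z)  (left x)  (right y) p q e = rank≢bound+ z x p e
rank-injective (left z)  (right x) (left y)  p q e = rank≢bound+ z y q (sym e)
rank-injective {a = a ∙ b} (left z) (right x) (right y) p q e = cong right
  (rank-injective (start b) x y (reach-start x) (reach-start y) (+-cancelˡ-≡ (bound a) _ _ e))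
rank-injective (right z) (right x) (right y) p q e = cong right (rank-injective z x y p q e)
rank-injective {a = a ^ω} (loop z) (loop x) (loop y) p q e with reach z x in zx | reach z y in zy
... | true  | true  = cong loop (rank-injective z x y zx zy e)
... | true  | false = rank≢bound+ z x zx e
... | false | true  = rank≢bound+ z y zy (sym e)
... | false | false = cong loop
  (rank-injective (start a) x y (reach-start x) (reach-start y) (+-cancelˡ-≡ (bound a) _ _ e))

infix 4 _<⟨_⟩_

record _<⟨_⟩_ {A : Set} {a : Word A} (x z y : Pos a) : Set where
  constructor before
  field
    reachˡ : reach z x ≡ true
    reachʳ : reach z y ≡ true
    rank<  : rank z x < rank z y

left⁺ : {z x y : Pos a} → x <⟨ z ⟩ y → left {b = b} x <⟨ left z ⟩ left y
left⁺ (before p q lt) = before p q lt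

left⁻ : {z x y : Pos a} → left {b = b} x <⟨ left z ⟩ left y → x <⟨ z ⟩ y
left⁻ (before p q lt) = before p q lt

right⁺ : {z x y : Pos b} → x <⟨ z ⟩ y → right {a = a} x <⟨ right z ⟩ right y
right⁺ (before p q lt) = before p q lt

right⁻ : {z x y : Pos b} → right {a = a} x <⟨ right z ⟩ right y → x <⟨ z ⟩ y
right⁻ (before p q lt) = before p q lt

left<right : {z x : Pos a} (y : Pos b) → reach z x ≡ true → left x <⟨ left z ⟩ right y
left<right {z = z} {x} y p = before p refl (<-≤-trans (rank<bound z x p) (m≤m+n _ _))

after⁺ : {z : Pos a} {x y : Pos b} → x <⟨ start b ⟩ y → right x <⟨ left z ⟩ right y
after⁺ {a = a} (before p q lt) = before refl refl (+-monoʳ-< (bound a) lt)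

after⁻ : {z : Pos a} {x y : Pos b} → right x <⟨ left z ⟩ right y → x <⟨ start b ⟩ y
after⁻ {a = a} {x = x} {y} (before p q lt) = before (reach-start x) (reach-start y) (+-cancelˡ-< (bound a) _ _ lt)

-- A position is either still ahead of `z` in the current pass or first met on the next one. Two
-- positions are thus ordered within this pass, across the return, or within the next pass.
data LoopOrder {A : Set} {a : Word A} (z x y : Pos a) : Set where
  pass   : x <⟨ z ⟩ y → LoopOrder z x y
  return : reach z x ≡ true → reach z y ≡ false → LoopOrder z x y
  again  : reach z x ≡ false → reach z y ≡ false → x <⟨ start a ⟩ y → LoopOrder z x y

loop⁻ : {z x y : Pos a} → loop x <⟨ loop z ⟩ loop y → LoopOrder z x y
loop⁻ {a = a} {z} {x} {y} (before _ _ lt) with reach z x in zx | reach z y in zy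
... | true  | true  = pass (before zx zy lt)
... | true  | false = return zx zy
... | false | true  = bound+≮rank z y zy lt
... | false | false = again zx zy
  (before (reach-start x) (reach-start y) (+-cancelˡ-< (bound a) _ _ lt))

loop⁺ : {z x y : Pos a} → LoopOrder z x y → loop x <⟨ loop z ⟩ loop y
loop⁺ {a = a} {z} {x} {y} (pass (before p q lt)) = before refl refl lemma
  where
  lemma : rank (loop z) (loop x) < rank (loop z) (loop y)
  lemma rewrite p | q = lt
loop⁺ {a = a} {z} {x} {y} (return p q) = before refl refl lemma
  where
  lemma : rank (loop z) (loop x) < rank (loop z) (loop y)
  lemma rewrite p | q = <-≤-trans (rank<bound z x p) (m≤m+n _ _)
loop⁺ {a = a} {z} {x} {y} (again p q (before _ _ lt)) = before refl refl lemma
  where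
  lemma : rank (loop z) (loop x) < rank (loop z) (loop y)
  lemma rewrite p | q = +-monoʳ-< (bound a) lt

-- Reading on loses positions only when it crosses a concatenation, and there the left part precedes
-- the right part in the order.
before⇒reach : {z x y : Pos a} → x <⟨ z ⟩ y → reach x y ≡ true
before⇒reach {z = here} {here} {here} _ = refl
before⇒reach {z = left z}  {left x}  {left y}  lt = before⇒reach (left⁻ lt)
before⇒reach {z = left z}  {left x}  {right y} lt = refl
before⇒reach {z = left z}  {right x} {left y}  (before _ q lt) = bound+≮rank z y q lt
before⇒reach {z = left z}  {right x} {right y} lt = before⇒reach (after⁻ lt)
before⇒reach {z = right z} {right x} {right y} lt = before⇒reach (right⁻ lt)
before⇒reach {z = loop z}  {loop x}  {loop y}  _  = refl

not-reached : (x y z : Pos a) → reach z x ≡ true → reach z y ≡ false → reach x y ≡ false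
not-reached x y z zx zy with reach x y in xy
... | false = refl
... | true  with () ← trans (sym zy) (reach-trans z x y zx xy)

-- Reading on from x, which is itself read from z, keeps the order of first visits.

before-shift : {z x y w : Pos a} → x <⟨ z ⟩ y → y <⟨ z ⟩ w → y <⟨ x ⟩ w
before-shift {z = here} {here} {here} {here} (before _ _ ()) _
before-shift {z = left z} {left x} {left y} {left w} p q = left⁺ (before-shift (left⁻ p) (left⁻ q))
before-shift {z = left z} {left x} {left y} {right w} p q = left<right w (before⇒reach (left⁻ p))
before-shift {z = left z} {x} {right y} {left w} p (before _ r lt) = bound+≮rank z w r lt
before-shift {z = left z} {left x} {right y} {right w} p q = after⁺ (after⁻ q)
before-shift {z = left z} {right x} {left y} {w} (before _ r lt) q = bound+≮rank z y r lt
before-shift {z = left z} {right x} {right y} {right w} p q = right⁺ (before-shift (after⁻ p) (after⁻ q))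
before-shift {z = right z} {right x} {right y} {right w} p q = right⁺ (before-shift (right⁻ p) (right⁻ q))
before-shift {z = loop z} {loop x} {loop y} {loop w} p q with loop⁻ p | loop⁻ q
... | pass p′         | pass q′         = loop⁺ (pass (before-shift p′ q′))
... | pass p′         | return _ r      = loop⁺ (return (before⇒reach p′) (not-reached x w z (_<⟨_⟩_.reachˡ p′) r))
... | pass p′         | again r _ _     with () ← trans (sym r) (_<⟨_⟩_.reachʳ p′)
... | return _ r      | pass q′         with () ← trans (sym r) (_<⟨_⟩_.reachˡ q′)
... | return _ r      | return r′ _     with () ← trans (sym r) r′
-- Here `x` is met on this pass, `y` and `w` only on the next. By transitivity of reaching they are
-- not ahead of `x` either.
... | return p′ _     | again r r′ q′   = loop⁺ (again (not-reached x y z p′ r) (not-reached x w z p′ r′) q′)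
... | again _ r _     | pass q′         with () ← trans (sym r) (_<⟨_⟩_.reachˡ q′)
... | again _ r _     | return r′ _     with () ← trans (sym r) r′
... | again _ _ p′    | again _ _ q′    = loop⁺ (pass (before-shift p′ q′))

self-or-before : (z y : Pos a) → reach z y ≡ true → z ≡ y ⊎ z <⟨ z ⟩ y
self-or-before z y r with rank z y in e
... | zero  = inj₁ (rank-injective z z y (reach-refl z) r (trans (rank-self z) (sym e)))
... | suc k = inj₂ (before (reach-refl z) r
  (subst (_< rank z y) (sym (rank-self z)) (subst (0 <_) (sym e) (s≤s z≤n))))

wordFrame : Word A → OrderFrame
wordFrame a = record
  { W        = Pos a
  ; nonempty = start a
  ; dom      = λ z y → reach z y ≡ true
  ; _<[_]_   = _<⟨_⟩_
  ; <-dom    = λ (before p q _) → p , q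
  ; <-isStrictTotalOrder = λ z → record
    { isStrictPartialOrder = record
      { isEquivalence = record { refl = refl ; sym = sym ; trans = trans }
      ; irrefl   = λ { refl (before _ _ lt) → <-irrefl refl lt }
      ; trans    = λ (before p _ lt) (before _ q lt′) → before p q (<-trans lt lt′)
      ; <-resp-≈ = (λ { refl lt → lt }) , (λ { refl lt → lt })
      }
    ; compare = compare z
    }
  ; <-wellFounded = λ z → Subrelation.wellFounded {_<₁_ = (λ x y → x <⟨ z ⟩ y) on proj₁} _<⟨_⟩_.rank<
      (On.wellFounded (λ x → rank z (proj₁ x)) <-wellFounded)
  ; <-centred = λ {z} {x} (before p _ _) → self-or-before z x p
  }
  where
  compare : ∀ z (x y : Σ[ x ∈ Pos a ] reach z x ≡ true) → _
  compare z (x , p) (y , q) with <-cmp (rank z x) (rank z y)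
  ... | tri< lt ne gt = tri< (before p q lt) (λ { refl → ne refl }) (λ b → gt (_<⟨_⟩_.rank< b))
  ... | tri≈ lt eq gt = tri≈ (λ b → lt (_<⟨_⟩_.rank< b)) (rank-injective z x y p q eq) (λ b → gt (_<⟨_⟩_.rank< b))
  ... | tri> lt ne gt = tri> (λ b → lt (_<⟨_⟩_.rank< b)) (λ { refl → ne refl }) (before q p gt)

module _ {A : Set} {a : Word A} where
  open OrderFrame (wordFrame a)

  R⇒reach : (z y : Pos a) → R z y → reach z y ≡ true
  R⇒reach z y (inj₁ refl)           = reach-refl z
  R⇒reach z y (inj₂ (before _ r _)) = r

wordFrame-finite : (a : Word A) → Finite (wordFrame a)
wordFrame-finite a = record { size = size a ; enum = enumerate a ; dom? = λ z y → reach z y ≟ᵇ true }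

wordFrame-flat : (a : Word A) → Flat (wordFrame a)
wordFrame-flat a = semiFlat , λ {x} {y} {z} p q →
  self-or-before x z (reach-trans x y z (R⇒reach x y p) (R⇒reach y z q))
  where
  semiFlat : SemiFlat (wordFrame a)
  semiFlat {w} {x} {y} x<y = self-or-before x y (before⇒reach x<y) , λ
    { (inj₁ y<z)              → before-shift x<y y<z
    -- Reaching is transitive, so whatever is accessible from `x` is accessible from `w`, a
    -- contradiction.
    ; {z} (inj₂ (Rxz , ¬Rwz)) → ⊥-elim (¬Rwz (self-or-before w z
        (reach-trans w x z (_<⟨_⟩_.reachˡ x<y) (R⇒reach x z Rxz)))) }

-- Words faithful to a coherent world

-- This is `m ^ (2 ^ n)`, the number of functions from `Subset n` to `Fin m`. Numbering them makes
-- the recurrence of a list a pigeonhole argument.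
keys : ℕ → ℕ → ℕ
keys zero    m = m
keys (suc n) m = keys n m * keys n m

key : ∀ {n m} → (Subset n → Fin m) → Fin (keys n m)
key {zero}  f = f []
key {suc n} f = combine (key (f ∘ (true ∷_))) (key (f ∘ (false ∷_)))

key-injective : ∀ {n m} (f g : Subset n → Fin m) → key f ≡ key g → ∀ C → f C ≡ g C
key-injective {zero}  f g e []          = e
key-injective {suc n} {m} f g e =
  λ { (true ∷ C)  → key-injective (f ∘ (true ∷_)) (g ∘ (true ∷_)) (proj₁ halves) C
    ; (false ∷ C) → key-injective (f ∘ (false ∷_)) (g ∘ (false ∷_)) (proj₂ halves) C }
  where
  halves : key (f ∘ (true ∷_)) ≡ key (g ∘ (true ∷_)) × key (f ∘ (false ∷_)) ≡ key (g ∘ (false ∷_))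
  halves = combine-injective {keys n m} {keys n m} _ _ _ _ e

key-cong : ∀ {n m} {f g : Subset n → Fin m} → (∀ C → f C ≡ g C) → key f ≡ key g
key-cong {zero}  e = e []
key-cong {suc n} e = cong₂ combine (key-cong λ C → e (true ∷ C)) (key-cong λ C → e (false ∷ C))

code : ∀ {n} → Maybe (Fin n) → Fin (suc n)
code nothing  = zero
code (just i) = suc i

code-injective : ∀ {n} {m m′ : Maybe (Fin n)} → code m ≡ code m′ → m ≡ m′
code-injective {m = nothing} {nothing} _ = refl
code-injective {m = just _}  {just _}  e = cong just (suc-injective e)

∣p∣<∣p∪⁅x⁆∣ : ∀ {n} {p : Subset n} {x} → x ∉ˢ p → ∣ p ∣ < ∣ p ∪ ⁅ x ⁆ ∣
∣p∣<∣p∪⁅x⁆∣ {p = p} {x} x∉p =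
  p⊂q⇒∣p∣<∣q∣ (p⊆p∪q ⁅ x ⁆ , x , q⊆p∪q p ⁅ x ⁆ (x∈⁅x⁆ x) , x∉p)

p∪⁅x⁆⊆q : ∀ {n} {p q : Subset n} {x} → p ⊆ q → x ∈ˢ q → p ∪ ⁅ x ⁆ ⊆ q
p∪⁅x⁆⊆q {p = p} {q} {x} p⊆q x∈q y∈ with x∈p∪q⁻ p ⁅ x ⁆ y∈
... | inj₁ y∈p = p⊆q y∈p
... | inj₂ y∈x = subst (_∈ˢ q) (sym (x∈⁅y⁆⇒x≡y x y∈x)) x∈q

module Selection {N : ℕ} (World : Set) (typ : World → Fin N)
  (sel : World → Subset N → Maybe (Fin N)) (next : World → Subset N → World)
  (Hint : World → Set) where

  -- sel w C is the type of the world next w C, which is the first world seen from w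
  -- whose type avoids C, or nothing if there is none.

  -- `flat` and `flat₂` come from Flattening, the latter one conditional deeper. As `next w C` need
  -- not be `w` even if `w` itself avoids `C`, `stay` records that it then has the same list. `hint`
  -- is carried along for the truth lemma.
  record Local (w : World) : Set where
    field
      centred  : ∀ {C} → typ w ∉ˢ C → sel w C ≡ just (typ w)
      selected : ∀ {C t} → sel w C ≡ just t → typ (next w C) ≡ t × t ∉ˢ C
      void     : ∀ {C C′} → C ⊆ C′ → sel w C ≡ nothing → sel w C′ ≡ nothing
      flat     : ∀ {C C′} → C ⊆ C′ → sel (next w C) C′ ≡ sel w C′
      flat₂    : ∀ {C C′} → C ⊆ C′ → ∀ D → sel (next (next w C) C′) D ≡ sel (next w C′) D
      stay     : ∀ {C} → typ w ∉ˢ C → ∀ D → sel (next w C) D ≡ sel w D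
      hint     : Hint w

  -- Finitely many theorems control only finitely many steps, hence the depth. Only steps with a
  -- selected type count, since otherwise `next` is junk.
  Coherent : ℕ → World → Set
  Coherent zero    w = Unit
  Coherent (suc n) w = Local w × (∀ C {t} → sel w C ≡ just t → Coherent n (next w C))

  Coherent-≤ : ∀ {m n} → m ≤ n → ∀ {w} → Coherent n w → Coherent m w
  Coherent-≤ z≤n       _       = tt
  Coherent-≤ (s≤s m≤n) (l , f) = l , λ C e → Coherent-≤ m≤n (f C e)

  -- The continuation required of a word leading from `w` out of `C`; it is empty if no world
  -- outside `C` is seen.
  exit : World → Subset N → Subset N → Maybe (Fin N)
  exit w C D = maybe (λ _ → sel (next w C) D) nothing (sel w C)

  exit-just : ∀ w C {t} → sel w C ≡ just t → ∀ D → exit w C D ≡ sel (next w C) D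
  exit-just w C e D rewrite e = refl

  exit-nothing : ∀ w C → sel w C ≡ nothing → ∀ D → exit w C D ≡ nothing
  exit-nothing w C e D rewrite e = refl

  exit-agrees : ∀ {w C D} → Local w → C ⊆ D → sel w D ≡ exit w C D
  exit-agrees {w} {C} l C⊆D with sel w C in e
  ... | nothing = Local.void l C⊆D e
  ... | just _  = sym (Local.flat l C⊆D)

  -- `flat` preserves the type met on leaving `C`, and `flat₂` the list seen from there.
  exit-next : ∀ {w S C t} → Local w → S ⊆ C → sel w S ≡ just t →
    ∀ D → exit (next w S) C D ≡ exit w C D
  exit-next {w} {S} {C} l S⊆C e D rewrite Local.flat l S⊆C with sel w C
  ... | nothing = refl
  ... | just _  = Local.flat₂ l S⊆C D

  -- The world reached past `S` already avoids `C`, so by `centred` and `stay` leaving `C` from it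
  -- changes nothing.
  exit-extend : ∀ {w S C} → Local w → (∀ {t} → sel w S ≡ just t → Local (next w S)) →
    S ⊆ C → (∀ {t} → sel w S ≡ just t → t ∉ˢ C) → ∀ D → exit w S D ≡ exit w C D
  exit-extend {w} {S} {C} l l′ S⊆C leaves D with sel w S in e
  ... | nothing = sym (exit-nothing w C (Local.void l S⊆C e) D)
  ... | just t  = trans (sym (Local.stay (l′ refl) out D)) (trans (Local.flat₂ l S⊆C D)
      (sym (exit-just w C (trans (sym (Local.flat l S⊆C)) (Local.centred (l′ refl) out)) D)))
    where
    out : typ (next w S) ∉ˢ C
    out = subst (_∉ˢ C) (sym (proj₁ (Local.selected l e))) (leaves refl)

  -- The initial sets of the list of types seen from `w`, in order of closeness.
  data Prefix (w : World) : Subset N → Set where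
    none : Prefix w ⊥
    snoc : ∀ {S t} → Prefix w S → sel w S ≡ just t → Prefix w (S ∪ ⁅ t ⁆)

  record Last (w : World) (C : Subset N) : Set where
    field
      {init}  : Subset N
      {last}  : Fin N
      prefix  : Prefix w init
      picked  : sel w init ≡ just last
      init⊆   : init ⊆ C
      last∈   : last ∈ˢ C
      split   : ∀ {s} → s ∈ˢ C → s ∈ˢ init ⊎ s ≡ last
      smaller : ∣ init ∣ < ∣ C ∣

  unsnoc : ∀ {w C} → Local w → Prefix w C → Nonempty C → Last w C
  unsnoc l none (x , x∈⊥) = ⊥-elim (∉⊥ x∈⊥)
  unsnoc l (snoc {S} {t} p e) _ = record
    { prefix = p ; picked = e ; init⊆ = p⊆p∪q ⁅ t ⁆ ; last∈ = q⊆p∪q S ⁅ t ⁆ (x∈⁅x⁆ t) ; split = split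
    ; smaller = ∣p∣<∣p∪⁅x⁆∣ (proj₂ (Local.selected l e)) }
    where
    split : ∀ {s} → s ∈ˢ S ∪ ⁅ t ⁆ → s ∈ˢ S ⊎ s ≡ t
    split s∈ with x∈p∪q⁻ S ⁅ t ⁆ s∈
    ... | inj₁ s∈S = inj₁ s∈S
    ... | inj₂ s∈t = inj₂ (x∈⁅y⁆⇒x≡y t s∈t)

  record MaximalPrefix (w : World) (C : Subset N) : Set where
    field
      {segment} : Subset N
      prefix    : Prefix w segment
      ⊆C        : segment ⊆ C
      leaves    : ∀ {t} → sel w segment ≡ just t → t ∉ˢ C

  -- Every type selected past `S` is new, so the fuel `m`, a bound on the types of `C` still
  -- missing, suffices.
  extend : ∀ {w C} → Local w → ∀ m {S} → Prefix w S → S ⊆ C → ∣ C ∣ ≤ m + ∣ S ∣ → MaximalPrefix w C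
  extend {w} {C} l m {S} p S⊆C C≤ with sel w S in e
  ... | nothing = record { prefix = p ; ⊆C = S⊆C ; leaves = λ e′ → nothing≢just (trans (sym e) e′) }
    where
    nothing≢just : ∀ {t} {A : Set} → nothing ≡ just t → A
    nothing≢just ()
  ... | just t with t ∈? C
  ...   | no t∉C = record { prefix = p ; ⊆C = S⊆C
                          ; leaves = λ e′ → subst (_∉ˢ C) (just-injective (trans (sym e) e′)) t∉C }
  ...   | yes t∈C with m
  ...     | zero  = ⊥-elim (<⇒≱ (∣p∣<∣p∪⁅x⁆∣ (proj₂ (Local.selected l e)))
                      (≤-trans (p⊆q⇒∣p∣≤∣q∣ (p∪⁅x⁆⊆q S⊆C t∈C)) C≤))
  ...     | suc m = extend l m (snoc p e) (p∪⁅x⁆⊆q S⊆C t∈C)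
                      (≤-trans C≤ (subst (_≤ m + ∣ S ∪ ⁅ t ⁆ ∣) (+-suc m ∣ S ∣)
                        (+-monoʳ-≤ m (∣p∣<∣p∪⁅x⁆∣ (proj₂ (Local.selected l e))))))

  maximalPrefix : ∀ {w C} → Local w → MaximalPrefix w C
  maximalPrefix {w} {C} l = extend l ∣ C ∣ none (⊆-min C) (m≤m+n _ _)

  -- The types read off a word from z onwards, and then the continuation e, select m.

  data First {a : Word World} (z : Pos a) (C : Subset N) (e m : Maybe (Fin N)) : Set where
    hit  : ∀ y → reach z y ≡ true → typ (at y) ∉ˢ C → (∀ x → x <⟨ z ⟩ y → typ (at x) ∈ˢ C) →
      m ≡ just (typ (at y)) → First z C e m
    miss : (∀ y → reach z y ≡ true → typ (at y) ∈ˢ C) → m ≡ e → First z C e m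

  -- This is required at every position, because each becomes a world with its own order. `E` is the
  -- list at the end of the word.
  Faithful : Word World → (Subset N → Maybe (Fin N)) → Set
  Faithful a E = ∀ (z : Pos a) C → First z C (E C) (sel (at z) C)

  head : Word World → World
  head a = at (start a)

  Faithful-resp : ∀ {a E E′} → (∀ C → E C ≡ E′ C) → Faithful a E → Faithful a E′
  Faithful-resp E≗E′ f z C = subst (λ e → First z C e (sel (at z) C)) (E≗E′ C) (f z C)

  letter-faithful : ∀ {w C} → Local w → (∀ {s} → s ∈ˢ C → s ≡ typ w) → Faithful (letter w) (exit w C)
  letter-faithful {w} l only here D with typ w ∈? D
  ... | no  w∉D = hit here refl w∉D (λ { here (before _ _ ()) }) (Local.centred l w∉D)
  -- All members of `C` equal `typ w`, so `C ⊆ D` and the search continues past the exit from `C`.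
  ... | yes w∈D = miss (λ { here _ → w∈D }) (exit-agrees l λ s∈C → subst (_∈ˢ D) (sym (only s∈C)) w∈D)

  ∙-faithful : ∀ {a b E} → Faithful a (sel (head b)) → Faithful b E → Faithful (a ∙ b) E
  ∙-faithful f g (left z) C with f z C
  ... | hit y r out least e = hit (left y) r out
        (λ { (left x) lt → least x (left⁻ lt) ; (right x) lt → left-final lt r }) e
    where
    left-final : ∀ {A : Set} {x y} → right x <⟨ left z ⟩ left y → reach z y ≡ true → A
    left-final (before _ _ lt) r = bound+≮rank z _ r lt
  ... | miss all e with g (start _) C
  ...   | hit y r out least e′ = hit (right y) refl out
          (λ { (left x) lt → all x (_<⟨_⟩_.reachˡ lt) ; (right x) lt → least x (after⁻ lt) }) (trans e e′)
  ...   | miss all′ e′ = miss (λ { (left y) r → all y r ; (right y) r → all′ y (reach-start y) }) (trans e e′)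
  ∙-faithful f g (right z) C with g z C
  ... | hit y r out least e = hit (right y) r out (λ { (right x) lt → least x (right⁻ lt) }) e
  ... | miss all e          = miss (λ { (right y) r → all y r }) e

  -- After the current pass, one pass from the start decides the search. If that misses too, `C`
  -- contains all types of `a`, and `close` supplies what follows the loop.
  ^ω-faithful : ∀ {a E} → Faithful a (sel (head a)) →
    (∀ {C} → (∀ (y : Pos a) → typ (at y) ∈ˢ C) → sel (head a) C ≡ E C) → Faithful (a ^ω) E
  ^ω-faithful {a} f close (loop z) C with f z C
  ... | hit y r out least e = hit (loop y) refl out (λ { (loop x) lt → least x (pass⁻ (loop⁻ lt)) }) e
    where
    pass⁻ : ∀ {x} → LoopOrder z x y → x <⟨ z ⟩ y
    pass⁻ (pass lt)     = lt
    pass⁻ (return _ ¬r) with () ← trans (sym ¬r) r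
    pass⁻ (again _ ¬r _) with () ← trans (sym ¬r) r
  ... | miss all e with f (start a) C
  ...   | miss all′ _ = miss (λ { (loop y) _ → all′ y (reach-start y) })
          (trans e (close λ y → all′ y (reach-start y)))
  ...   | hit y _ out least e′ = hit (loop y) refl out
          (λ { (loop x) lt → earlier (loop⁻ lt) }) (trans e e′)
    where
    earlier : ∀ {x} → LoopOrder z x y → typ (at x) ∈ˢ C
    earlier (pass lt)      = all _ (_<⟨_⟩_.reachˡ lt)
    earlier (return r _)   = all _ r
    earlier (again _ _ lt) = least _ lt

  -- A word for the part of the reading from `w` that leads out of `C`. Its head need only share the
  -- list of `w`, since a loop may begin at an earlier world. `covers` lets a loop be continued past
  -- `C`.
  record Filling (w : World) (C : Subset N) (E : Subset N → Maybe (Fin N)) : Set where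
    field
      word     : Word World
      locals   : ∀ (z : Pos word) → Local (at z)
      heads    : ∀ D → sel (head word) D ≡ sel w D
      faithful : Faithful word E
      covers   : ∀ {s} → s ∈ˢ C → ∃[ y ] typ (at {a = word} y) ≡ s

  Filling-resp : ∀ {w C E E′} → (∀ D → E D ≡ E′ D) → Filling w C E → Filling w C E′
  Filling-resp E≗E′ F = record { Filling F ; faithful = Faithful-resp E≗E′ (Filling.faithful F) }

  K : ℕ
  K = keys N (suc N)

  keyOf : World → Fin K
  keyOf w = key λ C → code (sel w C)

  keyOf-sel : ∀ {w w′} → keyOf w ≡ keyOf w′ → ∀ C → sel w C ≡ sel w′ C
  keyOf-sel e C = code-injective (key-injective _ _ e C)

  -- Filling a prefix of size n takes at most K rounds, each of which moves one world
  -- further on and looks two worlds ahead.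

  budget : ℕ → ℕ
  budget zero    = zero
  budget (suc n) = K + (3 + budget n)

  sel⇒typ : ∀ {w w′} → Local w → Local w′ → (∀ C → sel w C ≡ sel w′ C) → typ w ≡ typ w′
  sel⇒typ l l′ e = just-injective (trans (sym (Local.centred l ∉⊥)) (trans (e ⊥) (Local.centred l′ ∉⊥)))

  coherent⇒local : ∀ {n w} → Coherent (suc n) w → Local w
  coherent⇒local = proj₁

  maximal-nonempty : ∀ {w C} → Local w → typ w ∈ˢ C → (M : MaximalPrefix w C) → Nonempty (MaximalPrefix.segment M)
  maximal-nonempty {w} l w∈C M with nonempty? (MaximalPrefix.segment M)
  ... | yes ne = ne
  ... | no ¬ne = ⊥-elim (MaximalPrefix.leaves M
          (Local.centred l λ w∈ → ¬ne (typ w , w∈)) w∈C)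

  -- The inductive step: `fill` handles smaller sets, and `E` is the exit list of `C`, fixed while
  -- `w` moves on.
  module _ (n : ℕ)
    (fill : ∀ {w C} → Prefix w C → Nonempty C → ∣ C ∣ < n → Coherent (budget n) w → Filling w C (exit w C))
    {C : Subset N} (C≠∅ : Nonempty C) (C≤n : ∣ C ∣ ≤ n) (E : Subset N → Maybe (Fin N)) where

    -- A word read from an earlier world with list i up to w; it becomes a loop when w
    -- has list i as well.

    record Returning (i : Fin K) (w : World) : Set where
      field
        word     : Word World
        locals   : ∀ (z : Pos word) → Local (at z)
        headKey  : keyOf (head word) ≡ i
        faithful : Faithful word (sel w)
        covers   : ∀ {s} → s ∈ˢ C → (∃[ y ] typ (at {a = word} y) ≡ s) ⊎ s ≡ typ w

    -- Equal keys mean that the word ends with the list it began with, so it can be repeated. A set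
    -- containing all its types includes `C` by `covers`, and `exit-agrees` tells what follows.
    close : ∀ {w} → Local w → (∀ D → exit w C D ≡ E D) → Returning (keyOf w) w → Filling w C E
    close {w} l exits ret = record
      { word     = word ^ω
      ; locals   = λ { (loop z) → locals z }
      ; heads    = same
      ; faithful = ^ω-faithful (Faithful-resp (λ D → sym (same D)) faithful)
          λ {D} all → trans (same D) (trans (exit-agrees l λ s∈C → let (y , e) = covered s∈C in
            subst (_∈ˢ D) e (all y)) (exits D))
      ; covers   = λ s∈C → let (y , e) = covered s∈C in loop y , e
      }
      where
      open Returning ret

      same : ∀ D → sel (head word) D ≡ sel w D
      same = keyOf-sel headKey

      covered : ∀ {s} → s ∈ˢ C → ∃[ y ] typ (at {a = word} y) ≡ s
      covered s∈C with covers s∈C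
      ... | inj₁ found = found
      ... | inj₂ refl  = start word , sel⇒typ (locals (start word)) l same

    advance : ∀ {i w w′ S} → Local w → Filling w S (sel w′) → Returning i w → Returning i w′
    advance {w = w} l F ret = record
      { word     = R.word ∙ F.word
      ; locals   = λ { (left z) → R.locals z ; (right z) → F.locals z }
      ; headKey  = R.headKey
      ; faithful = ∙-faithful (Faithful-resp (λ D → sym (F.heads D)) R.faithful) F.faithful
      ; covers   = λ s∈C → inj₁ (covered (R.covers s∈C))
      }
      where
      module R = Returning ret
      module F = Filling F

      covered : ∀ {s} → (∃[ y ] typ (at {a = R.word} y) ≡ s) ⊎ s ≡ typ w →
        ∃[ y ] typ (at {a = R.word ∙ F.word} y) ≡ s
      covered (inj₁ (y , e)) = left y , e
      covered (inj₂ refl)    = right (start F.word) , sel⇒typ (F.locals (start F.word)) l F.heads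

    -- A word for `init` may leave only the last type of `C` uncovered, and that is the type of
    -- `w′`.
    embark : ∀ {w w′} (L : Last w C) → typ w′ ≡ Last.last L → Filling w (Last.init L) (sel w′) →
      Returning (keyOf w) w′
    embark {w} L w′≡last F = record
      { word     = F.word
      ; locals   = F.locals
      ; headKey  = key-cong λ D → cong code (F.heads D)
      ; faithful = F.faithful
      ; covers   = λ s∈C → covered (Last.split L s∈C)
      }
      where
      module F = Filling F

      covered : ∀ {s} → s ∈ˢ Last.init L ⊎ s ≡ Last.last L → _
      covered (inj₁ s∈) = inj₁ (F.covers s∈)
      covered (inj₂ e)  = inj₂ (trans e (sym w′≡last))

    join : ∀ {w w′ S} (L : Last w C) → Local w′ → typ w′ ≡ Last.last L → Filling w (Last.init L) (sel w′) →
      Filling w′ S E → Filling w C E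
    join {w} {w′} L l′ w′≡last F G = record
      { word     = F.word ∙ G.word
      ; locals   = λ { (left z) → F.locals z ; (right z) → G.locals z }
      ; heads    = F.heads
      ; faithful = ∙-faithful (Faithful-resp (λ D → sym (G.heads D)) F.faithful) G.faithful
      ; covers   = λ s∈C → covered (Last.split L s∈C)
      }
      where
      module F = Filling F
      module G = Filling G

      covered : ∀ {s} → s ∈ˢ Last.init L ⊎ s ≡ Last.last L →
        ∃[ y ] typ (at {a = F.word ∙ G.word} y) ≡ s
      covered (inj₁ s∈)   = let (y , e) = F.covers s∈ in left y , e
      covered (inj₂ refl) = right (start G.word) ,
        trans (sel⇒typ (G.locals (start G.word)) l′ G.heads) w′≡last

    single : ∀ {w} → Local w → (L : Last w C) → ¬ Nonempty (Last.init L) → (∀ D → exit w C D ≡ E D) → Filling w C E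
    single {w} l L ¬ne exits = record
      { word     = letter w
      ; locals   = λ { here → l }
      ; heads    = λ _ → refl
      ; faithful = Faithful-resp exits (letter-faithful l only)
      ; covers   = λ s∈C → here , sym (only s∈C)
      }
      where
      only : ∀ {s} → s ∈ˢ C → s ≡ typ w
      only s∈C with Last.split L s∈C
      ... | inj₁ s∈  = ⊥-elim (¬ne (_ , s∈))
      ... | inj₂ refl = just-injective (trans (sym (Last.picked L)) (Local.centred l λ w∈ → ¬ne (_ , w∈)))

    -- `seen` holds the keys of the worlds where earlier rounds began, each with a word leading from
    -- such a list to `w`. By the inequality the fuel `k` runs out only when all `K` keys are seen.
    run : ∀ k {w} (seen : Subset K) → K ≤ k + ∣ seen ∣ → Prefix w C → (∀ D → exit w C D ≡ E D) →
      Coherent (k + (3 + budget n)) w → (∀ {i} → i ∈ˢ seen → Returning i w) → Filling w C E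
    run k {w} seen K≤ p exits coh ret with keyOf w ∈? seen
    ... | yes old = close (coherent⇒local (Coherent-≤ (m≤n+m (3 + budget n) k) coh)) exits (ret old)
    ... | no  new = go (nonempty? init)
      where
      coh₃ : Coherent (3 + budget n) w
      coh₃ = Coherent-≤ (m≤n+m (3 + budget n) k) coh

      l : Local w
      l = coherent⇒local coh₃

      L : Last w C
      L = unsnoc l p C≠∅

      open Last L

      w′ : World
      w′ = next w init

      coh′ : Coherent (2 + budget n) w′
      coh′ = proj₂ coh₃ init picked

      l′ : Local w′
      l′ = coherent⇒local coh′

      w′≡last : typ w′ ≡ last
      w′≡last = proj₁ (Local.selected l picked)

      M : MaximalPrefix w′ C
      M = maximalPrefix l′

      module M = MaximalPrefix M

      S≠∅ : Nonempty M.segment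
      S≠∅ = maximal-nonempty l′ (subst (_∈ˢ C) (sym w′≡last) last∈) M

      exits″ : ∀ D → exit w′ C D ≡ E D
      exits″ D = trans (exit-next l init⊆ picked D) (exits D)

      exits′ : ∀ D → exit w′ M.segment D ≡ E D
      exits′ D = trans (exit-extend l′ (λ e → coherent⇒local (proj₂ coh′ M.segment e)) M.⊆C M.leaves D) (exits″ D)

      new-smaller : ∣ seen ∣ < ∣ seen ∪ ⁅ keyOf w ⁆ ∣
      new-smaller = ∣p∣<∣p∪⁅x⁆∣ new

      go : Dec (Nonempty init) → Filling w C E
      go (no empty) = single l L empty exits
      go (yes ne)   = join L l′ w′≡last F (rest (M.segment ⊂? C))
        where
        F : Filling w init (sel w′)
        F = Filling-resp (exit-just w init picked) (fill prefix ne (<-≤-trans smaller C≤n)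
          (Coherent-≤ (m≤n+m (budget n) 3) coh₃))

        repeat : ∀ k → K ≤ k + ∣ seen ∣ → Coherent (k + (3 + budget n)) w → C ⊆ M.segment → Filling w′ C E
        -- Adding the new key to `seen` would give more than `K` keys.
        repeat zero    K≤ coh C⊆S = ⊥-elim (<⇒≱ new-smaller (≤-trans (∣p∣≤n (seen ∪ ⁅ keyOf w ⁆)) K≤))
        repeat (suc k) K≤ coh C⊆S = run k (seen ∪ ⁅ keyOf w ⁆)
          (≤-trans K≤ (subst (_≤ k + ∣ seen ∪ ⁅ keyOf w ⁆ ∣) (+-suc k ∣ seen ∣) (+-monoʳ-≤ k new-smaller)))
          -- The segment equals `C`, so `C` is again initial at `w′` and another round starts.
          (subst (Prefix w′) (⊆-antisym M.⊆C C⊆S) M.prefix) exits″ (proj₂ coh init picked) returning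
          where
          returning : ∀ {i} → i ∈ˢ seen ∪ ⁅ keyOf w ⁆ → Returning i w′
          returning i∈ with x∈p∪q⁻ seen ⁅ keyOf w ⁆ i∈
          ... | inj₁ i∈seen = advance l F (ret i∈seen)
          ... | inj₂ i∈w    = subst (λ i → Returning i w′) (sym (x∈⁅y⁆⇒x≡y _ i∈w)) (embark L w′≡last F)

        rest : Dec (M.segment ⊂ C) → Filling w′ M.segment E
        -- The smaller segment is filled by induction, and leaving it already leaves `C`.
        rest (yes S⊂C) = Filling-resp exits′ (fill M.prefix S≠∅ (<-≤-trans (p⊂q⇒∣p∣<∣q∣ S⊂C) C≤n)
          (Coherent-≤ (m≤n+m (budget n) 2) coh′))
        rest (no S⊄C)  = subst (λ S → Filling w′ S E) (⊆-antisym C⊆S M.⊆C) (repeat k K≤ coh C⊆S)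
          where
          C⊆S : C ⊆ M.segment
          C⊆S {x} x∈C with x ∈? M.segment
          ... | yes x∈S = x∈S
          ... | no  x∉S = ⊥-elim (S⊄C (M.⊆C , x , x∈C , x∉S))

  fill : ∀ n {w C} → Prefix w C → Nonempty C → ∣ C ∣ < n → Coherent (budget n) w → Filling w C (exit w C)
  fill (suc n) {w} {C} p C≠∅ C<n coh = run n (fill n) C≠∅ (s≤s⁻¹ C<n) (exit w C) K ⊥ (m≤m+n K _) p
    (λ _ → refl) coh (λ i∈⊥ → ⊥-elim (∉⊥ i∈⊥))

  -- The maximal initial set inside `⊤` exhausts the types seen from `w`; nothing is selected past
  -- it, so the continuation is empty.
  coherent-word : ∀ {w} → Coherent (suc (budget (suc N))) w →
    Σ[ a ∈ Word World ] (∀ (z : Pos a) → Local (at z)) × Faithful a (λ _ → nothing) × (∀ D → sel (head a) D ≡ sel w D)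
  coherent-word {w} coh = F.word , F.locals , Faithful-resp (exit-nothing w M.segment unseen) F.faithful , F.heads
    where
    l : Local w
    l = coherent⇒local coh

    M : MaximalPrefix w ⊤
    M = maximalPrefix l

    module M = MaximalPrefix M

    unseen : sel w M.segment ≡ nothing
    unseen with sel w M.segment in e
    ... | nothing = refl
    ... | just t  = ⊥-elim (M.leaves e ∈⊤)

    F : Filling w M.segment (exit w M.segment)
    F = fill (suc N) M.prefix (maximal-nonempty l ∈⊤ M) (s≤s (∣p∣≤n M.segment)) (Coherent-≤ (n≤1+n _) coh)

    module F = Filling F

-- Valuations as worlds

bitToFin : Bool → Fin 2
bitToFin false = zero
bitToFin true  = suc zero

finToBit : Fin 2 → Bool
finToBit zero       = false
finToBit (suc zero) = true

finToBit-bitToFin : ∀ b → finToBit (bitToFin b) ≡ b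
finToBit-bitToFin false = refl
finToBit-bitToFin true  = refl

bitToFin-finToBit : ∀ i → bitToFin (finToBit i) ≡ i
bitToFin-finToBit zero       = refl
bitToFin-finToBit (suc zero) = refl

funToFin-cong : ∀ {m n} {f g : Fin m → Fin n} → (∀ i → f i ≡ g i) → funToFin f ≡ funToFin g
funToFin-cong {zero}  e = refl
funToFin-cong {suc m} e = cong₂ combine (e zero) (funToFin-cong λ i → e (suc i))

module Bits (k : ℕ) where

  encode : (Fin k → Bool) → Fin (2 ^ k)
  encode f = funToFin (bitToFin ∘ f)

  bit : Fin (2 ^ k) → Fin k → Bool
  bit t i = finToBit (finToFun t i)

  encode-cong : ∀ {f g} → (∀ i → f i ≡ g i) → encode f ≡ encode g
  encode-cong e = funToFin-cong λ i → cong bitToFin (e i)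

  bit-encode : ∀ f i → bit (encode f) i ≡ f i
  bit-encode f i = trans (cong finToBit (finToFun-funToFin (bitToFin ∘ f) i)) (finToBit-bitToFin (f i))

  encode-bit : ∀ t → encode (bit t) ≡ t
  encode-bit t = trans
    (funToFin-cong {k} {2} {bitToFin ∘ bit t} {finToFun t} λ i → bitToFin-finToBit (finToFun t i)) (funToFin-finToFin {k} {2} t)

⋀ : ∀ {n} → (Fin n → Form) → Form
⋀ {zero}  f = verum
⋀ {suc n} f = f zero ∧ ⋀ (f ∘ suc)

⊨-verum : ∀ v → v ⊨ verum
⊨-verum v = cong not (ev-falsum v)

⊨-⋀⁺ : ∀ {n} v (f : Fin n → Form) → (∀ i → v ⊨ f i) → v ⊨ ⋀ f
⊨-⋀⁺ {zero}  v f h = ⊨-verum v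
⊨-⋀⁺ {suc n} v f h = ⊨-∧⁺ v (f zero) (⋀ (f ∘ suc)) (h zero) (⊨-⋀⁺ v (f ∘ suc) (h ∘ suc))

⊨-⋀⁻ : ∀ {n} v (f : Fin n → Form) → v ⊨ ⋀ f → ∀ i → v ⊨ f i
⊨-⋀⁻ v f h zero    = proj₁ (⊨-∧⁻ v (f zero) (⋀ (f ∘ suc)) h)
⊨-⋀⁻ v f h (suc i) = ⊨-⋀⁻ v (f ∘ suc) (proj₂ (⊨-∧⁻ v (f zero) (⋀ (f ∘ suc)) h)) i

literal : Bool → Form → Form
literal true  p = p
literal false p = ∼ p

⊨-literal⁺ : ∀ v b p → ev v p ≡ b → v ⊨ literal b p
⊨-literal⁺ v true  p e = e
⊨-literal⁺ v false p e = cong not e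

⊨-literal⁻ : ∀ v b p → v ⊨ literal b p → ev v p ≡ b
⊨-literal⁻ v true  p e = e
⊨-literal⁻ v false p e with ev v p
... | false = refl

module Types (Φ : List Form) where

  private
    k : ℕ
    k = length Φ

  open Bits k public

  T : Set
  T = Fin (2 ^ k)

  φ : Fin k → Form
  φ = lookup Φ

  typ : Val → T
  typ v = encode (λ i → ev v (φ i))

  bit-typ : ∀ v i → bit (typ v) i ≡ ev v (φ i)
  bit-typ v i = bit-encode (λ i → ev v (φ i)) i

  τ : T → Form
  τ t = ⋀ λ i → literal (bit t i) (φ i)

  ⊨-τ⁺ : ∀ v → v ⊨ τ (typ v)
  ⊨-τ⁺ v = ⊨-⋀⁺ v _ λ i → ⊨-literal⁺ v (bit (typ v) i) (φ i) (sym (bit-typ v i))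

  ⊨-τ⁻ : ∀ v t → v ⊨ τ t → typ v ≡ t
  ⊨-τ⁻ v t h = trans
    (encode-cong λ i → ⊨-literal⁻ v (bit t i) (φ i) (⊨-⋀⁻ v (λ i → literal (bit t i) (φ i)) h i))
    (encode-bit t)

  exclude : Subset (2 ^ k) → T → Form
  exclude C t with t ∈? C
  ... | yes _ = ∼ τ t
  ... | no  _ = verum

  -- True under exactly the valuations whose type avoids `C`, so its conditionals describe the
  -- closest world outside `C`.
  ν : Subset (2 ^ k) → Form
  ν C = ⋀ (exclude C)

  ⊨-ν⁺ : ∀ v C → typ v ∉ˢ C → v ⊨ ν C
  ⊨-ν⁺ v C v∉C = ⊨-⋀⁺ v (exclude C) excluded
    where
    excluded : ∀ t → v ⊨ exclude C t
    excluded t with t ∈? C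
    ... | no  _   = ⊨-verum v
    ... | yes t∈C = cong not (¬-not λ v⊨τ → v∉C (subst (_∈ˢ C) (sym (⊨-τ⁻ v t v⊨τ)) t∈C))

  ⊨-ν⁻ : ∀ v C → v ⊨ ν C → typ v ∉ˢ C
  ⊨-ν⁻ v C h v∈C with typ v ∈? C | ⊨-⋀⁻ v (exclude C) h (typ v)
  ... | no v∉C | _  = v∉C v∈C
  ... | yes _  | h′ with () ← trans (sym h′) (cong not (⊨-τ⁺ v))

  ⊢-ν-antitone : ∀ {C C′} → C ⊆ C′ → ⊢C2F (ν C′ ⇒ ν C)
  ⊢-ν-antitone {C} {C′} C⊆C′ = ⊢-⇒ λ v h → ⊨-ν⁺ v C λ v∈C → ⊨-ν⁻ v C′ h (C⊆C′ v∈C)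

  next : Val → Subset (2 ^ k) → Val
  next v C = shift (ν C) v

  select : Bool → (Fin k → Bool) → Maybe T
  select true  f = nothing
  select false f = just (encode f)

  sel : Val → Subset (2 ^ k) → Maybe T
  sel v C = select (v (ν C > falsum)) (λ i → v (ν C > φ i))

  sel-just⁻ : ∀ {v C t} → sel v C ≡ just t → Possible (ν C) v × encode (λ i → v (ν C > φ i)) ≡ t
  sel-just⁻ {v} {C} e with v (ν C > falsum)
  ... | false = refl , just-injective e

  sel-nothing⁻ : ∀ {v C} → sel v C ≡ nothing → v ⊨ ν C > falsum
  sel-nothing⁻ {v} {C} e with v (ν C > falsum)
  ... | true = refl

  sel-cong : ∀ {v C v′ C′} → v (ν C > falsum) ≡ v′ (ν C′ > falsum) →
    (∀ i → v (ν C > φ i) ≡ v′ (ν C′ > φ i)) → sel v C ≡ sel v′ C′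
  sel-cong {v} {C} {v′} {C′} e f rewrite e with v′ (ν C′ > falsum)
  ... | true  = refl
  ... | false = cong just (encode-cong f)

  -- `ν (failing i)` is provably equivalent to `φ i`, so a selection answers conditionals with
  -- antecedent `φ i`.
  failing : Fin k → Subset (2 ^ k)
  failing i = tabulate λ t → not (bit t i)

  ∈-failing⁺ : ∀ {t i} → bit t i ≡ false → t ∈ˢ failing i
  ∈-failing⁺ {t} {i} e = lookup⇒[]= t _ (trans (lookup∘tabulate _ t) (cong not e))

  ∈-failing⁻ : ∀ {t i} → t ∈ˢ failing i → bit t i ≡ false
  ∈-failing⁻ {t} {i} t∈ with bit t i | trans (sym (lookup∘tabulate (λ t → not (bit t i)) t)) ([]=⇒lookup t∈)
  ... | false | _ = refl

  ∉-failing⁺ : ∀ v i → v ⊨ φ i → typ v ∉ˢ failing i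
  ∉-failing⁺ v i h v∈ with () ← trans (sym h) (trans (sym (bit-typ v i)) (∈-failing⁻ v∈))

  ∉-failing⁻ : ∀ v i → typ v ∉ˢ failing i → v ⊨ φ i
  ∉-failing⁻ v i v∉ = ¬-not λ e → v∉ (∈-failing⁺ (trans (bit-typ v i) e))

  -- The default `true` is the value of a vacuous conditional.
  Hint : Val → Set
  Hint v = ∀ i j → v (φ i > φ j) ≡ maybe (λ t → bit t j) true (sel v (failing i))

  open Selection Val typ sel next Hint public

  enf-⊆ : ∀ {P : Subset (2 ^ k) → Subset (2 ^ k) → Val → Set} →
    (∀ C C′ → C ⊆ C′ → Enforced (P C C′)) → Enforced (λ v → ∀ C C′ → C ⊆ C′ → P C C′ v)
  enf-⊆ {P} f = enf-Subset λ C → enf-Subset λ C′ → decided C C′ (C ⊆? C′)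
    where
    decided : ∀ C C′ → Dec (C ⊆ C′) → Enforced (λ v → C ⊆ C′ → P C C′ v)
    decided C C′ (yes C⊆C′) = enf-map (λ v p _ → p) (f C C′ C⊆C′)
    decided C C′ (no C⊈C′)  = always λ v → ⊥-elim ∘ C⊈C′

  enf-sel : ∀ {Q : Val → Set} {X Y : Val → Val} →
    (∀ p q → Enforced (λ v → Q v → X v (p > q) ≡ Y v (p > q))) →
    Enforced (λ v → Q v → ∀ D → sel (X v) D ≡ sel (Y v) D)
  enf-sel {X = X} {Y} f = enf-map
    (λ v h Qv D → sel-cong {X v} {D} {Y v} {D} (proj₁ (h D) Qv) (λ i → proj₂ (h D) i Qv))
    (enf-Subset λ D → enf-× (f (ν D) falsum) (enf-Fin λ i → f (ν D) (φ i)))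

  enf-centred : Enforced (λ v → ∀ C → typ v ∉ˢ C → sel v C ≡ just (typ v))
  enf-centred = enf-Subset λ C → enf-map₂ (lemma C)
    (enf-centering (ν C) falsum) (enf-Fin λ i → enf-centering (ν C) (φ i))
    where
    lemma : ∀ C v → (v ⊨ ν C → v (ν C > falsum) ≡ ev v falsum) →
      (∀ i → v ⊨ ν C → v (ν C > φ i) ≡ ev v (φ i)) → typ v ∉ˢ C → sel v C ≡ just (typ v)
    lemma C v f g v∉C rewrite trans (f (⊨-ν⁺ v C v∉C)) (ev-falsum v) =
      cong just (encode-cong λ i → g i (⊨-ν⁺ v C v∉C))

  enf-selected : Enforced (λ v → ∀ C {t} → sel v C ≡ just t → typ (next v C) ≡ t × t ∉ˢ C)
  enf-selected = enf-Subset λ C → enf-map₂ (lemma C)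
    (enf-Fin λ i → enf-shift (ν C) (φ i))
    (enf-× (enf-shift (ν C) (ν C)) (⊢-enforced (c2 (identity (ν C)))))
    where
    lemma : ∀ C v → (∀ i → Possible (ν C) v → ev (next v C) (φ i) ≡ v (ν C > φ i)) →
      (Possible (ν C) v → ev (next v C) (ν C) ≡ v (ν C > ν C)) × v ⊨ ν C > ν C →
      ∀ {t} → sel v C ≡ just t → typ (next v C) ≡ t × t ∉ˢ C
    lemma C v f (g , h) {t} e = typ≡t , subst (_∉ˢ C) typ≡t (⊨-ν⁻ (next v C) C (trans (g possible) h))
      where
      possible : Possible (ν C) v
      possible = proj₁ (sel-just⁻ {v} {C} e)

      typ≡t : typ (next v C) ≡ t
      typ≡t = trans (encode-cong λ i → f i possible) (proj₂ (sel-just⁻ {v} {C} e))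

  enf-voidness : Enforced (λ v → ∀ C C′ → C ⊆ C′ → sel v C ≡ nothing → sel v C′ ≡ nothing)
  enf-voidness = enf-⊆ λ C C′ C⊆C′ → enf-map (lemma C C′) (enf-void (⊢-ν-antitone C⊆C′))
    where
    lemma : ∀ C C′ v → (v ⊨ ν C > falsum → v ⊨ ν C′ > falsum) → sel v C ≡ nothing → sel v C′ ≡ nothing
    lemma C C′ v f e rewrite f (sel-nothing⁻ {v} {C} e) = refl

  enf-flat : Enforced (λ v → ∀ C C′ → C ⊆ C′ → sel (next v C) C′ ≡ sel v C′)
  enf-flat = enf-⊆ λ C C′ C⊆C′ → enf-map₂ (λ v → sel-cong {next v C} {C′} {v} {C′})
    (enf-flattening falsum (⊢-ν-antitone C⊆C′))
    (enf-Fin λ i → enf-flattening (φ i) (⊢-ν-antitone C⊆C′))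

  enf-flat₂ : Enforced (λ v → ∀ C C′ → C ⊆ C′ → ∀ D → sel (next (next v C) C′) D ≡ sel (next v C′) D)
  enf-flat₂ = enf-⊆ λ C C′ C⊆C′ → enf-map (λ v h → h tt)
    (enf-sel {X = λ v → next (next v C) C′} {Y = λ v → next v C′}
      λ p q → enf-map (λ v e _ → e) (enf-flattening (p > q) (⊢-ν-antitone C⊆C′)))

  enf-stay : Enforced (λ v → ∀ C → typ v ∉ˢ C → ∀ D → sel (next v C) D ≡ sel v D)
  enf-stay = enf-Subset λ C → enf-sel {X = λ v → next v C} {Y = λ v → v} λ p q →
    enf-map (λ v e v∉C → e (⊨-ν⁺ v C v∉C)) (enf-centering (ν C) (p > q))

  enf-hint : Enforced Hint
  enf-hint = enf-Fin λ i → enf-Fin λ j → enf-map₂ (lemma i j)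
    (enf-substitute (φ j) (⊢-⇒ λ v h → ⊨-ν⁺ v (failing i) (∉-failing⁺ v i h))
      (⊢-⇒ λ v h → ∉-failing⁻ v i (⊨-ν⁻ v (failing i) h)))
    (enf-monotone (ν (failing i)) {falsum} {φ j} (⊢-⇒ λ v → ⊭-falsum v))
    where
    lemma : ∀ i j v → v (φ i > φ j) ≡ v (ν (failing i) > φ j) →
      (v ⊨ ν (failing i) > falsum → v ⊨ ν (failing i) > φ j) →
      v (φ i > φ j) ≡ maybe (λ t → bit t j) true (sel v (failing i))
    lemma i j v e f with v (ν (failing i) > falsum)
    ... | true  = trans e (f refl)
    ... | false = trans e (sym (bit-encode _ j))

  enf-Local : Enforced Local
  enf-Local = enf-map₂
    (λ { v (a , b , c) (d , e , f , g) → record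
      { centred = a _ ; selected = b _ ; void = c _ _ ; flat = d _ _ ; flat₂ = e _ _ ; stay = f _ ; hint = g } })
    (enf-× enf-centred (enf-× enf-selected enf-voidness))
    (enf-× enf-flat (enf-× enf-flat₂ (enf-× enf-stay enf-hint)))

  -- `enf-Possible` moves coherence of smaller depth to each closest `ν C`-world, and there are
  -- finitely many sets `C`.
  enf-Coherent : ∀ n → Enforced (Coherent n)
  enf-Coherent zero    = always λ v → tt
  enf-Coherent (suc n) = enf-map₂ (λ v l f → l , λ C {t} e → f C (proj₁ (sel-just⁻ {v} {C} e)))
    enf-Local (enf-Subset λ C → enf-Possible (ν C) (enf-Coherent n))

-- Truth in word models and completeness

subformulas : Form → List Form
properSubformulas : Form → List Form

subformulas p = p ∷ properSubformulas p

properSubformulas (atom k) = []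
properSubformulas (∼ p)    = subformulas p
properSubformulas (p ∧ q)  = subformulas p ++ subformulas q
properSubformulas (p > q)  = subformulas p ++ subformulas q

wordModel : Word Val → OrderModel
wordModel a = record { frame = wordFrame a ; V = λ k z → at z (atom k) }

module _ (Φ : List Form) where
  open Types Φ

  position : ∀ {q} → q ∈ₗ Φ → ∃[ i ] φ i ≡ q
  position q∈ = Any.index q∈ , sym (lookup-index q∈)

  module _ (a : Word Val) (locals : ∀ (z : Pos a) → Local (at z)) (faithful : Faithful a (λ _ → nothing)) where
    open OrderModel (wordModel a)

    -- `hint` reads the conditional off the selection for `failing i`, and faithfulness locates it
    -- at the first position satisfying `φ i`. As nothing follows the word, a miss means that no
    -- accessible position satisfies `φ i`.
    truth-> : ∀ i j →
      (∀ z → (⟦ φ i ⟧ z → at z ⊨ φ i) × (at z ⊨ φ i → ⟦ φ i ⟧ z)) →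
      (∀ z → (⟦ φ j ⟧ z → at z ⊨ φ j) × (at z ⊨ φ j → ⟦ φ j ⟧ z)) →
      ∀ z → (⟦ φ i > φ j ⟧ z → at z ⊨ φ i > φ j) × (at z ⊨ φ i > φ j → ⟦ φ i > φ j ⟧ z)
    truth-> i j ihᵢ ihⱼ z with faithful z (failing i)
    ... | miss all e =
      (λ _ → trans (Local.hint (locals z) i j) (cong (maybe (λ t → bit t j) true) e)) ,
      (λ _ → inj₁ λ y (Rzy , ⟦i⟧y) →
        ∉-failing⁺ (at y) i (proj₁ (ihᵢ y) ⟦i⟧y) (all y (R⇒reach z y Rzy)))
    ... | hit y r out least e = (λ h → trans value (there-holds h)) , λ h →
        inj₂ (y , (self-or-before z y r , proj₂ (ihᵢ y) (∉-failing⁻ (at y) i out) , proj₂ (ihⱼ y) (trans (sym value) h)) ,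
          λ {x} x<y ⟦i⟧x → ∉-failing⁺ (at x) i (proj₁ (ihᵢ x) ⟦i⟧x) (least x x<y))
      where
      value : ev (at z) (φ i > φ j) ≡ ev (at y) (φ j)
      value = trans (Local.hint (locals z) i j) (trans (cong (maybe (λ t → bit t j) true) e) (bit-typ (at y) j))

      there-holds : ⟦ φ i > φ j ⟧ z → at y ⊨ φ j
      there-holds (inj₁ empty) = ⊥-elim (empty y
        (self-or-before z y r , proj₂ (ihᵢ y) (∉-failing⁻ (at y) i out)))
      there-holds (inj₂ (x , (Rzx , ⟦i⟧x , ⟦j⟧x) , first)) with <-cmp (rank z x) (rank z y)
      ... | tri< lt _ _ = ⊥-elim (∉-failing⁺ (at x) i (proj₁ (ihᵢ x) ⟦i⟧x)
              (least x (before (R⇒reach z x Rzx) r lt)))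
      ... | tri> _ _ gt = ⊥-elim (first (before r (R⇒reach z x Rzx) gt)
              (proj₂ (ihᵢ y) (∉-failing⁻ (at y) i out)))
      ... | tri≈ _ eq _ with refl ← rank-injective z x y (R⇒reach z x Rzx) r eq = proj₁ (ihⱼ x) ⟦j⟧x

    truth : ∀ q → (∀ {r} → r ∈ₗ subformulas q → r ∈ₗ Φ) →
      ∀ z → (⟦ q ⟧ z → at z ⊨ q) × (at z ⊨ q → ⟦ q ⟧ z)
    truth (atom k) sub z = (λ h → h) , (λ h → h)
    truth (∼ q)    sub z =
      (λ h → cong not (¬-not λ e → h (proj₂ ih e))) , (λ h ⟦q⟧z → not-¬ h (cong not (proj₁ ih ⟦q⟧z)))
      where
      ih : (⟦ q ⟧ z → at z ⊨ q) × (at z ⊨ q → ⟦ q ⟧ z)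
      ih = truth q (λ r∈ → sub (there r∈)) z
    truth (q ∧ r)  sub z =
      (λ (x , y) → ⊨-∧⁺ (at z) q r (proj₁ ihq x) (proj₁ ihr y)) ,
      (λ h → let (x , y) = ⊨-∧⁻ (at z) q r h in proj₂ ihq x , proj₂ ihr y)
      where
      ihq : (⟦ q ⟧ z → at z ⊨ q) × (at z ⊨ q → ⟦ q ⟧ z)
      ihq = truth q (λ s∈ → sub (there (∈-++⁺ˡ s∈))) z

      ihr : (⟦ r ⟧ z → at z ⊨ r) × (at z ⊨ r → ⟦ r ⟧ z)
      ihr = truth r (λ s∈ → sub (there (∈-++⁺ʳ (subformulas q) s∈))) z
    truth (q > r)  sub
      with position (sub (there (∈-++⁺ˡ {xs = subformulas q} (here refl))))
         | position (sub (there (∈-++⁺ʳ (subformulas q) (here refl))))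
         | truth q (λ s∈ → sub (there (∈-++⁺ˡ s∈)))
         | truth r (λ s∈ → sub (there (∈-++⁺ʳ (subformulas q) s∈)))
    ... | i , refl | j , refl | ihq | ihr = truth-> i j ihq ihr

theorem4p4 : (p : Form) →
    ((M : OrderModel) → Finite (OrderModel.frame M) → Flat (OrderModel.frame M) →
    (w : OrderModel.W M) → w ∈ OrderModel.⟦_⟧ M p) →
    ⊢C2F p
theorem4p4 p valid = enforced-⊢ (enf-map satisfies (enf-Coherent (suc (budget (suc (2 ^ length Φ))))))
  where
  Φ : List Form
  Φ = subformulas p

  open Types Φ

  satisfies : ∀ v → Coherent (suc (budget (suc (2 ^ length Φ)))) v → v ⊨ p
  satisfies v coh with coherent-word coh
  -- The head of the word has the type of `v`, and entry `zero` of `Φ` is `p` itself, so truth of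
  -- `p` there transfers to `v`.
  ... | a , locals , faithful , heads = trans (sym (bit-typ v zero))
    (trans (cong (λ t → bit t zero) (sym (sel⇒typ (locals (start a)) (coherent⇒local coh) heads)))
      (trans (bit-typ (head a) zero) (proj₁ (truth Φ a locals faithful p (λ r∈ → r∈) (start a))
        (valid (wordModel a) (wordFrame-finite a) (wordFrame-flat a) (start a)))))
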